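{- There exist absolute constants $c,C>0$ such that the following holds. Let $G=(V,E)$ be a finite connected triangle-free non-bipartite graph satisfying $CD(0,\infty)$. Then the eigenvalues $0=\lambda_1<\lambda_2\le\cdots\le\lambda_{|V|}$ of the Laplacian $\Delta$ satisfy \[ \frac{c}{dD^2}\leq \lambda_2\leq \cdots\leq \lambda_{|V|}\leq 2-\frac{C}{dD^2}, \] where $d$ is the maximal vertex degree and $D$ the diameter of $G$.
   Context: $G$ is a finite simple connected graph with degrees $d_x$. The Laplacian is $\Delta f(x)=\frac{1}{d_x}\sum_{y\sim x}(f(y)-f(x))$, with eigenvalues defined by $-\Delta f=\lambda f$, $f\ne0$. $\Gamma(f,g)=\frac12\{\Delta(fg)-g\Delta f-f\Delta g\}$, $\Gamma_2(f,g)=\frac12\{\Delta\Gamma(f,g)-\Gamma(g,\Delta f)-\Gamma(f,\Delta g)\}$. $G$ satisfies $CD(0,\infty)$ if $\Gamma_2(f,f)(x)\ge 0$ for all $f:V\to\mathbb{R}$ and all $x\in V$. -}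

module Defs where

open import Data.Bool.Base using (Bool)
open import Data.Fin.Base as Fin using (Fin)
open import Data.Integer.Base using (+_)
open import Data.List.Base as List using (List; allFin; filter; foldr; length)
open import Data.List.Extrema.Nat using (max)
open import Data.Nat.Base as ℕ using (ℕ; zero; suc; _⊔_)
import Data.Nat.Properties as ℕ
open import Data.Product.Base using (∃; ∃₂; _×_; _,_)
open import Data.Rational.Base as ℚ using (ℚ; 0ℚ; 1ℚ; ½; ∣_∣; 1/_)
import Data.Rational.Properties as ℚ
open import Data.Rational.Solver using (module +-*-Solver)
open import Relation.Binary.Core using (Rel)
open import Relation.Binary.Definitions using (Decidable; Irreflexive; Symmetric)
open import Relation.Binary.PropositionalEquality using (_≡_; _≢_; refl; sym; trans; cong)
open import Relation.Nullary using (¬_)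
open import Level using (0ℓ)

open +-*-Solver using (solve; _:+_; _:*_; _:-_; :-_; _:=_)

-- Real numbers: Cauchy sequences of rationals, compared by the setoid
-- equality _≃_.

IsCauchy : (ℕ → ℚ) → Set
IsCauchy s = ∀ ε → 0ℚ ℚ.< ε →
  ∃ λ N → ∀ m k → N ℕ.≤ m → N ℕ.≤ k → ∣ s m ℚ.- s k ∣ ℚ.≤ ε

record ℝ : Set where
  constructor mkℝ
  field
    seq    : ℕ → ℚ
    cauchy : IsCauchy seq

open ℝ public

infix  4 _≃_ _≤_ _<_
infixl 6 _+_ _-_
infixl 7 _*_ _÷_
infix  8 -_

_≃_ _≤_ _<_ : ℝ → ℝ → Set
x ≃ y = ∀ ε → 0ℚ ℚ.< ε → ∃ λ N → ∀ n → N ℕ.≤ n → ∣ seq x n ℚ.- seq y n ∣ ℚ.≤ ε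
x ≤ y = ∀ ε → 0ℚ ℚ.< ε → ∃ λ N → ∀ n → N ℕ.≤ n → seq x n ℚ.≤ seq y n ℚ.+ ε
x < y = ∃ λ ε → 0ℚ ℚ.< ε × ∃ λ N → ∀ n → N ℕ.≤ n → seq x n ℚ.+ ε ℚ.≤ seq y n

private
  half-pos : ∀ {ε} → 0ℚ ℚ.< ε → 0ℚ ℚ.< ½ ℚ.* ε
  half-pos 0<ε = ℚ.*-monoʳ-<-pos ½ 0<ε

  half+half : ∀ ε → ½ ℚ.* ε ℚ.+ ½ ℚ.* ε ≡ ε
  half+half ε = trans (sym (ℚ.*-distribʳ-+ ε ½ ½)) (ℚ.*-identityˡ ε)

  const-cauchy : ∀ q → IsCauchy (λ _ → q)
  const-cauchy q ε 0<ε =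
    0 , λ _ _ _ _ → ℚ.≤-trans (ℚ.≤-reflexive (cong ∣_∣ (ℚ.+-inverseʳ q))) (ℚ.<⇒≤ 0<ε)

  +-cauchy : ∀ s t → IsCauchy s → IsCauchy t → IsCauchy (λ n → s n ℚ.+ t n)
  +-cauchy s t cs ct ε 0<ε with cs _ (half-pos 0<ε) | ct _ (half-pos 0<ε)
  ... | M , hs | N , ht = M ⊔ N , λ m k p q → begin
    ∣ (s m ℚ.+ t m) ℚ.- (s k ℚ.+ t k) ∣
      ≡⟨ cong ∣_∣ (solve 4 (λ a b c d → (a :+ b) :- (c :+ d) := (a :- c) :+ (b :- d))
                   refl (s m) (t m) (s k) (t k)) ⟩
    ∣ (s m ℚ.- s k) ℚ.+ (t m ℚ.- t k) ∣
      ≤⟨ ℚ.∣p+q∣≤∣p∣+∣q∣ (s m ℚ.- s k) (t m ℚ.- t k) ⟩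
    ∣ s m ℚ.- s k ∣ ℚ.+ ∣ t m ℚ.- t k ∣
      ≤⟨ ℚ.+-mono-≤ (hs m k (ℕ.m⊔n≤o⇒m≤o M N p) (ℕ.m⊔n≤o⇒m≤o M N q))
                    (ht m k (ℕ.m⊔n≤o⇒n≤o M N p) (ℕ.m⊔n≤o⇒n≤o M N q)) ⟩
    ½ ℚ.* ε ℚ.+ ½ ℚ.* ε
      ≡⟨ half+half ε ⟩
    ε ∎
    where open ℚ.≤-Reasoning

  neg-cauchy : ∀ s → IsCauchy s → IsCauchy (λ n → ℚ.- s n)
  neg-cauchy s cs ε 0<ε with cs ε 0<ε
  ... | N , hs = N , λ m k p q → begin
    ∣ ℚ.- s m ℚ.- ℚ.- s k ∣
      ≡⟨ cong ∣_∣ (solve 2 (λ a b → :- a :- :- b := :- (a :- b)) refl (s m) (s k)) ⟩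
    ∣ ℚ.- (s m ℚ.- s k) ∣
      ≡⟨ ℚ.∣-p∣≡∣p∣ (s m ℚ.- s k) ⟩
    ∣ s m ℚ.- s k ∣
      ≤⟨ hs m k p q ⟩
    ε ∎
    where open ℚ.≤-Reasoning

  eventually-bounded : ∀ s → IsCauchy s →
    ∃₂ λ N B → 0ℚ ℚ.< B × (∀ n → N ℕ.≤ n → ∣ s n ∣ ℚ.≤ B)
  eventually-bounded s cs with cs 1ℚ (ℚ.positive⁻¹ 1ℚ)
  ... | N , h = N , 1ℚ ℚ.+ ∣ s N ∣ ,
    ℚ.<-≤-trans (ℚ.positive⁻¹ 1ℚ)
      (ℚ.≤-trans (ℚ.≤-reflexive (sym (ℚ.+-identityʳ 1ℚ))) (ℚ.+-monoʳ-≤ 1ℚ (ℚ.0≤∣p∣ (s N)))) ,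
    λ n p → begin
      ∣ s n ∣
        ≡⟨ cong ∣_∣ (solve 2 (λ a b → a := (a :- b) :+ b) refl (s n) (s N)) ⟩
      ∣ (s n ℚ.- s N) ℚ.+ s N ∣
        ≤⟨ ℚ.∣p+q∣≤∣p∣+∣q∣ (s n ℚ.- s N) (s N) ⟩
      ∣ s n ℚ.- s N ∣ ℚ.+ ∣ s N ∣
        ≤⟨ ℚ.+-monoˡ-≤ ∣ s N ∣ (h n N p ℕ.≤-refl) ⟩
      1ℚ ℚ.+ ∣ s N ∣ ∎
    where open ℚ.≤-Reasoning

  *-mono-∣∣ : ∀ {p q A B} → ∣ p ∣ ℚ.≤ A → ∣ q ∣ ℚ.≤ B → ∣ p ℚ.* q ∣ ℚ.≤ A ℚ.* B
  *-mono-∣∣ {p} {q} {A} {B} p≤A q≤B = begin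
    ∣ p ℚ.* q ∣     ≡⟨ ℚ.∣p*q∣≡∣p∣*∣q∣ p q ⟩
    ∣ p ∣ ℚ.* ∣ q ∣ ≤⟨ ℚ.*-monoʳ-≤-nonNeg ∣ q ∣ {{ℚ.nonNegative (ℚ.0≤∣p∣ q)}} p≤A ⟩
    A ℚ.* ∣ q ∣     ≤⟨ ℚ.*-monoˡ-≤-nonNeg A {{ℚ.nonNegative (ℚ.≤-trans (ℚ.0≤∣p∣ p) p≤A)}} q≤B ⟩
    A ℚ.* B ∎
    where open ℚ.≤-Reasoning

  ε/M : ∀ {ε M} → 0ℚ ℚ.< ε → 0ℚ ℚ.< M → ∃ λ δ → 0ℚ ℚ.< δ × δ ℚ.* M ≡ ε
  ε/M {ε} {M} 0<ε 0<M = ε ℚ.* 1/M , 0<δ , δM≡ε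
    where
    instance
      M>0 = ℚ.positive 0<M
      M≢0 = ℚ.pos⇒nonZero M

    1/M = 1/ M

    0<δ : 0ℚ ℚ.< ε ℚ.* 1/M
    0<δ = ℚ.positive⁻¹ _
      {{ℚ.pos*pos⇒pos ε {{ℚ.positive 0<ε}} 1/M {{ℚ.1/pos⇒pos M}}}}

    δM≡ε : ε ℚ.* 1/M ℚ.* M ≡ ε
    δM≡ε = trans (ℚ.*-assoc ε 1/M M)
      (trans (cong (ε ℚ.*_) (ℚ.*-inverseˡ M)) (ℚ.*-identityʳ ε))

  *-close : ∀ a b c d {A B δ} → ∣ a ∣ ℚ.≤ A → ∣ d ∣ ℚ.≤ B →
    ∣ b ℚ.- d ∣ ℚ.≤ δ → ∣ a ℚ.- c ∣ ℚ.≤ δ →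
    ∣ a ℚ.* b ℚ.- c ℚ.* d ∣ ℚ.≤ δ ℚ.* (A ℚ.+ B)
  *-close a b c d {A} {B} {δ} a≤A d≤B b-d a-c = begin
    ∣ a ℚ.* b ℚ.- c ℚ.* d ∣
      ≡⟨ cong ∣_∣ (solve 4 (λ a b c d → a :* b :- c :* d := (b :- d) :* a :+ (a :- c) :* d)
                   refl a b c d) ⟩
    ∣ (b ℚ.- d) ℚ.* a ℚ.+ (a ℚ.- c) ℚ.* d ∣
      ≤⟨ ℚ.∣p+q∣≤∣p∣+∣q∣ ((b ℚ.- d) ℚ.* a) ((a ℚ.- c) ℚ.* d) ⟩
    ∣ (b ℚ.- d) ℚ.* a ∣ ℚ.+ ∣ (a ℚ.- c) ℚ.* d ∣
      ≤⟨ ℚ.+-mono-≤ (*-mono-∣∣ {b ℚ.- d} {a} b-d a≤A) (*-mono-∣∣ {a ℚ.- c} {d} a-c d≤B) ⟩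
    δ ℚ.* A ℚ.+ δ ℚ.* B
      ≡⟨ ℚ.*-distribˡ-+ δ A B ⟨
    δ ℚ.* (A ℚ.+ B) ∎
    where open ℚ.≤-Reasoning

  *-cauchy : ∀ s t → IsCauchy s → IsCauchy t → IsCauchy (λ n → s n ℚ.* t n)
  *-cauchy s t cs ct ε 0<ε =
    let M₁ , A , 0<A , bs = eventually-bounded s cs
        N₁ , B , 0<B , bt = eventually-bounded t ct
        δ , 0<δ , δ[A+B]≡ε = ε/M 0<ε (ℚ.+-mono-< 0<A 0<B)
        M₂ , hs = cs δ 0<δ
        N₂ , ht = ct δ 0<δ
        N = (M₁ ⊔ N₁) ⊔ (M₂ ⊔ N₂)
        ≥₁ = λ {m} (p : N ℕ.≤ m) → ℕ.m⊔n≤o⇒m≤o (M₁ ⊔ N₁) (M₂ ⊔ N₂) p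
        ≥₂ = λ {m} (p : N ℕ.≤ m) → ℕ.m⊔n≤o⇒n≤o (M₁ ⊔ N₁) (M₂ ⊔ N₂) p
    in N , λ m k p q →
      ℚ.≤-trans
        (*-close (s m) (t m) (s k) (t k)
          (bs m (ℕ.m⊔n≤o⇒m≤o M₁ N₁ (≥₁ p)))
          (bt k (ℕ.m⊔n≤o⇒n≤o M₁ N₁ (≥₁ q)))
          (ht m k (ℕ.m⊔n≤o⇒n≤o M₂ N₂ (≥₂ p)) (ℕ.m⊔n≤o⇒n≤o M₂ N₂ (≥₂ q)))
          (hs m k (ℕ.m⊔n≤o⇒m≤o M₂ N₂ (≥₂ p)) (ℕ.m⊔n≤o⇒m≤o M₂ N₂ (≥₂ q))))
        (ℚ.≤-reflexive δ[A+B]≡ε)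

fromℚ : ℚ → ℝ
fromℚ q = mkℝ (λ _ → q) (const-cauchy q)

0ℝ 1ℝ 2ℝ : ℝ
0ℝ = fromℚ 0ℚ
1ℝ = fromℚ 1ℚ
2ℝ = fromℚ (+ 2 ℚ./ 1)

_+_ _*_ : ℝ → ℝ → ℝ
x + y = mkℝ (λ n → seq x n ℚ.+ seq y n) (+-cauchy (seq x) (seq y) (cauchy x) (cauchy y))
x * y = mkℝ (λ n → seq x n ℚ.* seq y n) (*-cauchy (seq x) (seq y) (cauchy x) (cauchy y))

-_ : ℝ → ℝ
- x = mkℝ (λ n → ℚ.- seq x n) (neg-cauchy (seq x) (cauchy x))

_-_ : ℝ → ℝ → ℝ
x - y = x + - y

-- Division by a natural number, with x ÷ 0 = 0.  In a connected
-- non-bipartite graph all degrees and the diameter are positive, so this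
-- value at 0 plays no role there.
_÷_ : ℝ → ℕ → ℝ
x ÷ zero      = 0ℝ
x ÷ n@(suc _) = fromℚ (+ 1 ℚ./ n) * x

∑ : ∀ {A : Set} → List A → (A → ℝ) → ℝ
∑ xs f = foldr (λ a r → f a + r) 0ℝ xs

record Graph (n : ℕ) : Set₁ where
  infix 4 _∼_ _∼?_
  field
    _∼_      : Rel (Fin n) 0ℓ
    _∼?_     : Decidable _∼_
    ∼-sym    : Symmetric _∼_
    ∼-irrefl : Irreflexive _≡_ _∼_

module _ {n : ℕ} (G : Graph n) where

  open Graph G using (_∼_; _∼?_)

  neighbours : Fin n → List (Fin n)
  neighbours x = filter (x ∼?_) (allFin n)

  degree : Fin n → ℕ
  degree x = length (neighbours x)

  maxDegree : ℕ
  maxDegree = max 0 (List.map degree (allFin n))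

  data Walk : Fin n → Fin n → ℕ → Set where
    here : ∀ {x} → Walk x x 0
    step : ∀ {x y z k} → x ∼ y → Walk y z k → Walk x z (suc k)

  Connected : Set
  Connected = ∀ x y → ∃ λ k → Walk x y k

  Distance : Fin n → Fin n → ℕ → Set
  Distance x y k = Walk x y k × (∀ m → Walk x y m → k ℕ.≤ m)

  IsDiameter : ℕ → Set
  IsDiameter D = (∀ x y → ∃ λ k → Distance x y k × k ℕ.≤ D)
               × (∃₂ λ x y → Distance x y D)

  TriangleFree : Set
  TriangleFree = ∀ x y z → x ∼ y → y ∼ z → ¬ (z ∼ x)

  Bipartite : Set
  Bipartite = ∃ λ (colour : Fin n → Bool) → ∀ x y → x ∼ y → colour x ≢ colour y

  Δ : (Fin n → ℝ) → Fin n → ℝ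
  Δ f x = ∑ (neighbours x) (λ y → f y - f x) ÷ degree x

  Γ : (f g : Fin n → ℝ) → Fin n → ℝ
  Γ f g x = (Δ (λ y → f y * g y) x - g x * Δ f x - f x * Δ g x) ÷ 2

  Γ₂ : (f g : Fin n → ℝ) → Fin n → ℝ
  Γ₂ f g x = (Δ (Γ f g) x - Γ g (Δ f) x - Γ f (Δ g) x) ÷ 2

  CD0∞ : Set
  CD0∞ = ∀ f x → 0ℝ ≤ Γ₂ f f x

  IsEigenfunction : ℝ → (Fin n → ℝ) → Set
  IsEigenfunction μ f = ¬ (∀ x → f x ≃ 0ℝ) × (∀ x → - Δ f x ≃ μ * f x)

  LinearlyIndependent : (Fin n → Fin n → ℝ) → Set
  LinearlyIndependent φ = ∀ (a : Fin n → ℝ) →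
    (∀ x → ∑ (allFin n) (λ i → a i * φ i x) ≃ 0ℝ) → ∀ i → a i ≃ 0ℝ

  Spanning : (Fin n → Fin n → ℝ) → Set
  Spanning φ = ∀ (f : Fin n → ℝ) →
    ∃ λ (a : Fin n → ℝ) → ∀ x → f x ≃ ∑ (allFin n) (λ i → a i * φ i x)

  -- ev lists the eigenvalues of -Δ in nondecreasing order, each repeated
  -- according to its multiplicity: its entries are the eigenvalues of the
  -- members of a basis of eigenfunctions.  Such a basis exists because Δ is
  -- self-adjoint for the inner product ∑ₓ dₓ f(x) g(x).
  IsSpectrum : (Fin n → ℝ) → Set
  IsSpectrum ev =
    (∀ i j → i Fin.≤ j → ev i ≤ ev j)
    × ∃ λ (φ : Fin n → Fin n → ℝ) →
        (∀ i → IsEigenfunction (ev i) (φ i)) × LinearlyIndependent φ × Spanning φ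

{-# OPTIONS --safe #-}
module Submission where

-- Put c = C = 1/100 and θ = c / (d D²).  For a sign s = ± 1 let
-- Δˢ f(x) = (1/dₓ) ∑_{y ∼ x} (s f(y) - f(x)).  As G is triangle-free, multiplying f
-- by s on the sphere around x turns Δˢ into Δ near x, so CD(0,∞) also gives a Bochner
-- inequality for Δˢ.  Let - Δˢ f = μ f with μ ≤ θ and |f| maximal at x₀.  The maximum
-- principle for E + 4 θ f², where E(x) = (1/dₓ) ∑_{y ∼ x} (s f(y) - f(x))², yields
-- E ≤ 8 θ f(x₀)², and adding up along a walk from x₀ of length at most 3D bounds the
-- change of f, up to the sign s, by less than |f(x₀)|.
--   For s = 1 it follows that f has a constant sign, hence is harmonic (μ = 0); two
-- such eigenvalues would give a nonzero harmonic function with a zero.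
--   For s = - 1, where μ = 2 - λ, a non-bipartite graph has an edge joining vertices
-- at distances of equal parity from x₀; an odd closed walk of length at most 2D + 1
-- through x₀ results, along which f would have to change its sign.
--   The reals are constructive, but x ≤ y is stable under double negation, which
-- allows case distinctions and maxima over the vertices whenever an inequality or
-- a contradiction is to be proved.

open import Algebra.Bundles using (CommutativeRing)
import Algebra.Solver.Ring as RingSolver
import Algebra.Solver.Ring.AlmostCommutativeRing as ACR
open import Data.Bool.Base using (Bool; true; false; not; if_then_else_)
open import Data.Empty using (⊥; ⊥-elim)
open import Data.Fin.Base as Fin using (Fin; zero; suc; inject≤; opposite)
open import Data.Integer.Base using (+_)
import Data.Integer.Solver as ℤSolver
open import Data.List.Base as List using (List; []; _∷_; foldr; length; allFin)
open import Data.List.Extrema.Nat using (xs≤max)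
open import Data.List.Membership.Propositional using (_∈_)
open import Data.List.Membership.Propositional.Properties
  using (∈-filter⁻; ∈-filter⁺; ∈-allFin; ∈-tabulate⁻; ∈-map⁺; ∈-length)
open import Data.List.Relation.Unary.All as All using (All)
import Data.List.Relation.Unary.Any as Any
open import Data.Maybe.Base as Maybe using (Maybe)
open import Data.Nat.Base as ℕ using (ℕ; zero; suc; _^_; _⊔_; z≤n; s≤s)
import Data.Nat.Properties as ℕ
open import Data.Product.Base using (Σ; ∃; ∃₂; _×_; _,_; proj₁; proj₂)
open import Data.Rational.Base as ℚ using (ℚ; 0ℚ; 1ℚ; ½; ∣_∣; 1/_)
import Data.Rational.Properties as ℚ
open import Data.Rational.Solver using (module +-*-Solver)
import Data.Rational.Unnormalised.Base as ℚᵘ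
import Data.Rational.Unnormalised.Properties as ℚᵘ
open import Data.Sum.Base using (_⊎_; inj₁; inj₂)
open import Defs using (Graph; neighbours; degree; maxDegree; Walk; here; step;
  Connected; IsDiameter; TriangleFree; Bipartite)
open import Function.Base using (_∘_)
open import Level using (0ℓ)
open import Relation.Binary.PropositionalEquality as ≡ using (_≡_; _≢_; cong; subst)
open import Relation.Binary.Structures using (IsEquivalence)
open import Relation.Nullary using (¬_; Dec; yes; no)
open import Relation.Nullary.Decidable.Core using (dec⇒maybe)

-- Stable ordered rings

private module Z = ℤSolver.+-*-Solver

-- An iterated sum of ones rather than a fraction, so that the successor step is literally an
-- addition and passes through ring homomorphisms.
natℚ : ℕ → ℚ
natℚ zero    = 0ℚ
natℚ (suc k) = 1ℚ ℚ.+ natℚ k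

toℚᵘ-natℚ : ∀ k → ℚ.toℚᵘ (natℚ k) ℚᵘ.≃ ℚᵘ.mkℚᵘ (+ k) 0
toℚᵘ-natℚ zero    = ℚᵘ.≃-refl
toℚᵘ-natℚ (suc k) = ℚᵘ.≃-trans (ℚ.toℚᵘ-homo-+ 1ℚ (natℚ k))
  (ℚᵘ.≃-trans (ℚᵘ.+-congʳ ℚᵘ.1ℚᵘ (toℚᵘ-natℚ k))
    (ℚᵘ.*≡* (Z.solve 1 (λ k → (Z.con (+ 1) Z.:* Z.con (+ 1) Z.:+ k Z.:* Z.con (+ 1)) Z.:* Z.con (+ 1)
      Z.:= (Z.con (+ 1) Z.:+ k) Z.:* (Z.con (+ 1) Z.:* Z.con (+ 1))) ≡.refl (+ k))))

natℚ-nonNeg : ∀ k → 0ℚ ℚ.≤ natℚ k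
natℚ-nonNeg zero    = ℚ.≤-refl
natℚ-nonNeg (suc k) = ℚ.≤-trans (natℚ-nonNeg k)
  (subst (ℚ._≤ natℚ (suc k)) (ℚ.+-identityˡ (natℚ k))
    (ℚ.+-monoˡ-≤ (natℚ k) (ℚ.nonNegative⁻¹ 1ℚ)))

-- The fraction is kept in lowest terms and does not reduce for a variable `k`; in the unnormalised
-- rationals the equation becomes an identity of integers.
natℚ*1/n : ∀ k → natℚ (suc k) ℚ.* (+ 1 ℚ./ suc k) ≡ 1ℚ
natℚ*1/n k = ℚ.toℚᵘ-injective (ℚᵘ.≃-trans (ℚ.toℚᵘ-homo-* (natℚ (suc k)) (+ 1 ℚ./ suc k))
  (ℚᵘ.≃-trans (ℚᵘ.*-cong (toℚᵘ-natℚ (suc k)) (ℚ.toℚᵘ-fromℚᵘ (ℚᵘ.mkℚᵘ (+ 1) k)))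
    (ℚᵘ.*≡* (Z.solve 1 (λ m → (m Z.:* Z.con (+ 1)) Z.:* Z.con (+ 1)
      Z.:= Z.con (+ 1) Z.:* (Z.con (+ 1) Z.:* m)) ≡.refl (+ suc k)))))

0<1/n : ∀ n → 0ℚ ℚ.< + 1 ℚ./ suc n
0<1/n n = ℚ.positive⁻¹ _ {{ℚ.normalize-pos 1 (suc n)}}

1/100 72/100 2ℚ 4ℚ 8ℚ : ℚ
1/100  = + 1 ℚ./ 100
72/100 = + 72 ℚ./ 100
2ℚ     = + 2 ℚ./ 1
4ℚ     = + 4 ℚ./ 1
8ℚ     = + 8 ℚ./ 1

-- Order axioms that hold constructively for the reals and suffice for the graph argument. Instead
-- of totality there are `≤-stable` and `≰⇒≥`, and strict positivity is written `¬ (x ≤ 0#)`. The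
-- map `ι` gives the ring solver rational coefficients.
record StableOrderedRing : Set₁ where
  infix 4 _≤_
  field
    commutativeRing : CommutativeRing 0ℓ 0ℓ
  open CommutativeRing commutativeRing public using (Carrier; _≈_; _+_; _*_; -_; 0#; 1#)
  field
    _≤_       : Carrier → Carrier → Set
    ≈⇒≤       : ∀ {x y} → x ≈ y → x ≤ y
    ≤-trans   : ∀ {x y z} → x ≤ y → y ≤ z → x ≤ z
    ≤-antisym : ∀ {x y} → x ≤ y → y ≤ x → x ≈ y
    ≤-stable  : ∀ {x y} → ¬ ¬ (x ≤ y) → x ≤ y
    ≰⇒≥       : ∀ {x y} → ¬ (x ≤ y) → y ≤ x
    +-mono-≤  : ∀ {x y u v} → x ≤ y → u ≤ v → x + u ≤ y + v
    0≤*       : ∀ {x y} → 0# ≤ x → 0# ≤ y → 0# ≤ x * y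
    0<*       : ∀ {x y} → ¬ (x ≤ 0#) → ¬ (y ≤ 0#) → ¬ (x * y ≤ 0#)
    ι         : CommutativeRing.rawRing ℚ.+-*-commutativeRing
                  ACR.-Raw-AlmostCommutative⟶ ACR.fromCommutativeRing commutativeRing
  fromℚ : ℚ → Carrier
  fromℚ = ACR._-Raw-AlmostCommutative⟶_.⟦_⟧ ι
  field
    fromℚ-nonNeg : ∀ {q} → 0ℚ ℚ.≤ q → 0# ≤ fromℚ q
    fromℚ-pos    : ∀ {q} → 0ℚ ℚ.< q → ¬ (fromℚ q ≤ 0#)

module OrderedRingProperties (K : StableOrderedRing) where

  open StableOrderedRing K public
  open CommutativeRing commutativeRing public
    using (_-_; -‿inverseʳ; +-identityˡ; +-identityʳ; zeroˡ; zeroʳ; setoid;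
      refl; sym; trans; +-cong; *-cong; -‿cong)

  fromℚ-cong : ∀ {p q} → p ≡ q → fromℚ p ≈ fromℚ q
  fromℚ-cong ≡.refl = refl

  fromℚ-≟ : ∀ p q → Maybe (fromℚ p ≈ fromℚ q)
  fromℚ-≟ p q = Maybe.map fromℚ-cong (dec⇒maybe (p ℚ.≟ q))

  module Sol = RingSolver (CommutativeRing.rawRing ℚ.+-*-commutativeRing)
    (ACR.fromCommutativeRing commutativeRing) ι fromℚ-≟
  open Sol using (solve; con; _:+_; _:*_; _:-_; :-_; _:=_)

  open import Relation.Binary.Reasoning.Setoid setoid

  ≈-stable : ∀ {x y} → ¬ ¬ (x ≈ y) → x ≈ y
  ≈-stable h = ≤-antisym (≤-stable λ k → h (k ∘ ≈⇒≤)) (≤-stable λ k → h (k ∘ ≈⇒≤ ∘ sym))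

  x≤y⇒0≤y-x : ∀ {x y} → x ≤ y → 0# ≤ y - x
  x≤y⇒0≤y-x {x} {y} h = ≤-trans (≈⇒≤ (sym (-‿inverseʳ x))) (+-mono-≤ h (≈⇒≤ refl))

  0≤y-x⇒x≤y : ∀ {x y} → 0# ≤ y - x → x ≤ y
  0≤y-x⇒x≤y {x} {y} h = ≤-trans (≈⇒≤ (sym (+-identityˡ x)))
    (≤-trans (+-mono-≤ h (≈⇒≤ refl)) (≈⇒≤ (solve 2 (λ x y → (y :- x) :+ x := y) refl x y)))

  ≤-refl : ∀ {x} → x ≤ x
  ≤-refl = ≈⇒≤ refl

  ≤-respˡ-≈ : ∀ {x y z} → x ≈ y → x ≤ z → y ≤ z
  ≤-respˡ-≈ e h = ≤-trans (≈⇒≤ (sym e)) h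

  ≤-respʳ-≈ : ∀ {x y z} → x ≈ y → z ≤ x → z ≤ y
  ≤-respʳ-≈ e h = ≤-trans h (≈⇒≤ e)

  0≤⇒≤ : ∀ {x y r} → 0# ≤ r → y - x ≈ r → x ≤ y
  0≤⇒≤ 0≤r e = 0≤y-x⇒x≤y (≤-respʳ-≈ (sym e) 0≤r)

  0≤+ : ∀ {x y} → 0# ≤ x → 0# ≤ y → 0# ≤ x + y
  0≤+ 0≤x 0≤y = ≤-respˡ-≈ (+-identityˡ 0#) (+-mono-≤ 0≤x 0≤y)

  -- If `x ≤ y` failed, the first branch would refute `u ≤ v`, so `≰⇒≥` gives `v ≤ u` and the second
  -- branch applies; stability removes the double negation.
  ≤-by-cases : ∀ {x y u v} → (u ≤ v → x ≤ y) → (v ≤ u → x ≤ y) → x ≤ y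
  ≤-by-cases f g = ≤-stable λ x≰y → x≰y (g (≰⇒≥ (x≰y ∘ f)))

  x≤0⇒0≤-x : ∀ {x} → x ≤ 0# → 0# ≤ - x
  x≤0⇒0≤-x {x} h = ≤-respʳ-≈ (+-identityˡ (- x)) (x≤y⇒0≤y-x h)

  0≤-x⇒x≤0 : ∀ {x} → 0# ≤ - x → x ≤ 0#
  0≤-x⇒x≤0 {x} h = 0≤⇒≤ h (+-identityˡ (- x))

  0≤x*x : ∀ x → 0# ≤ x * x
  0≤x*x x = ≤-by-cases (λ 0≤x → 0≤* 0≤x 0≤x) λ x≤0 →
    ≤-respʳ-≈ (solve 1 (λ x → (:- x) :* (:- x) := x :* x) refl x)
      (0≤* (x≤0⇒0≤-x x≤0) (x≤0⇒0≤-x x≤0))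

  -- If `x` were not nonnegative, `- x` would be strictly positive, and hence `c * (- x)` too.
  *-cancel-0≤ : ∀ {c x} → ¬ (c ≤ 0#) → 0# ≤ c * x → 0# ≤ x
  *-cancel-0≤ {c} {x} 0<c 0≤cx = ≤-stable λ 0≰x → 0<* 0<c
    (λ -x≤0 → 0≰x (≤-respʳ-≈ (solve 1 (λ x → :- (:- x) := x) refl x) (x≤0⇒0≤-x -x≤0)))
    (0≤-x⇒x≤0 (≤-respʳ-≈ (solve 2 (λ c x → c :* x := :- (c :* (:- x))) refl c x) 0≤cx))

  *-cancel-≈0 : ∀ {c x} → ¬ (c ≤ 0#) → c * x ≈ 0# → x ≈ 0#
  *-cancel-≈0 {c} {x} 0<c cx≈0 = ≤-antisym
    (0≤-x⇒x≤0 (*-cancel-0≤ 0<c (≤-respʳ-≈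
      (solve 2 (λ c x → :- (c :* x) := c :* (:- x)) refl c x) (x≤0⇒0≤-x (≈⇒≤ cx≈0)))))
    (*-cancel-0≤ 0<c (≈⇒≤ (sym cx≈0)))

  -- Neither `x` nor `- x` can be strictly positive, since the square would be as well.
  x*x≤0⇒x≈0 : ∀ {x} → x * x ≤ 0# → x ≈ 0#
  x*x≤0⇒x≈0 {x} xx≤0 = ≤-antisym (≤-stable λ x≰0 → 0<* x≰0 x≰0 xx≤0)
    (≤-stable λ 0≰x → let 0<-x = λ -x≤0 → 0≰x (≤-respʳ-≈ (solve 1 (λ x → :- (:- x) := x) refl x)
                                        (x≤0⇒0≤-x -x≤0))
      in 0<* 0<-x 0<-x (≤-respˡ-≈ (solve 1 (λ x → x :* x := (:- x) :* (:- x)) refl x) xx≤0))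

  *-monoʳ-≤ : ∀ {c x y} → 0# ≤ c → x ≤ y → c * x ≤ c * y
  *-monoʳ-≤ {c} {x} {y} 0≤c x≤y = 0≤⇒≤ (0≤* 0≤c (x≤y⇒0≤y-x x≤y))
    (solve 3 (λ c x y → c :* y :- c :* x := c :* (y :- x)) refl c x y)

  *-monoˡ-≤ : ∀ {c x y} → 0# ≤ c → x ≤ y → x * c ≤ y * c
  *-monoˡ-≤ {c} {x} {y} 0≤c x≤y = 0≤⇒≤ (0≤* 0≤c (x≤y⇒0≤y-x x≤y))
    (solve 3 (λ c x y → y :* c :- x :* c := c :* (y :- x)) refl c x y)

  -- A maximum cannot be located by comparing values, but its absence is contradictory: if the first
  -- value is not below the maximum of the rest, it is itself the maximum.
  ¬¬argmax : ∀ {m} (F : Fin (suc m) → Carrier) → ¬ ¬ (∃ λ x → ∀ y → F y ≤ F x)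
  ¬¬argmax {zero}  F k = k (zero , λ { zero → ≤-refl })
  ¬¬argmax {suc m} F k = ¬¬argmax (F ∘ suc) λ (x , max) →
    let top : ¬ (F zero ≤ F (suc x))
        top h = k (suc x , λ { zero → h ; (suc y) → max y })
    in k (zero , λ { zero → ≤-refl ; (suc y) → ≤-trans (max y) (≰⇒≥ top) })

  open ACR._-Raw-AlmostCommutative⟶_ ι public using (+-homo; *-homo; 0-homo)

  -- Natural numbers and their reciprocals in the ring.

  nat : ℕ → Carrier
  nat k = fromℚ (natℚ k)

  nat-suc : ∀ k → nat (suc k) ≈ fromℚ 1ℚ + nat k
  nat-suc k = +-homo 1ℚ (natℚ k)

  0≤nat : ∀ k → 0# ≤ nat k
  0≤nat k = fromℚ-nonNeg (natℚ-nonNeg k)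

  0<nat : ∀ k → ¬ (nat (suc k) ≤ 0#)
  0<nat k = fromℚ-pos (ℚ.positive⁻¹ _
    {{ℚ.pos+nonNeg⇒pos 1ℚ (natℚ k) {{ℚ.nonNegative (natℚ-nonNeg k)}}}})

  0<nat⁺ : ∀ {k} → 1 ℕ.≤ k → ¬ (nat k ≤ 0#)
  0<nat⁺ {suc k} _ = 0<nat k

  nat-+ : ∀ j k → nat (j ℕ.+ k) ≈ nat j + nat k
  nat-+ zero    k = trans (sym (+-identityˡ (nat k))) (+-cong (sym 0-homo) refl)
  nat-+ (suc j) k = begin
    nat (suc (j ℕ.+ k))            ≈⟨ nat-suc (j ℕ.+ k) ⟩
    fromℚ 1ℚ + nat (j ℕ.+ k)       ≈⟨ +-cong refl (nat-+ j k) ⟩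
    fromℚ 1ℚ + (nat j + nat k)     ≈⟨ solve 3 (λ a b c → a :+ (b :+ c) := (a :+ b) :+ c) refl
                                       (fromℚ 1ℚ) (nat j) (nat k) ⟩
    (fromℚ 1ℚ + nat j) + nat k     ≈⟨ +-cong (sym (nat-suc j)) refl ⟩
    nat (suc j) + nat k            ∎

  nat-* : ∀ j k → nat (j ℕ.* k) ≈ nat j * nat k
  nat-* zero    k = solve 1 (λ a → con 0ℚ := con 0ℚ :* a) refl (nat k)
  nat-* (suc j) k = begin
    nat (k ℕ.+ j ℕ.* k)            ≈⟨ nat-+ k (j ℕ.* k) ⟩
    nat k + nat (j ℕ.* k)          ≈⟨ +-cong refl (nat-* j k) ⟩
    nat k + nat j * nat k          ≈⟨ solve 2 (λ a b → b :+ a :* b := (con 1ℚ :+ a) :* b) refl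
                                        (nat j) (nat k) ⟩
    (fromℚ 1ℚ + nat j) * nat k     ≈⟨ *-cong (sym (nat-suc j)) refl ⟩
    nat (suc j) * nat k            ∎

  nat-mono-≤ : ∀ {j k} → j ℕ.≤ k → nat j ≤ nat k
  nat-mono-≤ {j} {k} j≤k = ≤-respʳ-≈ (trans (sym (nat-+ j (k ℕ.∸ j)))
      (fromℚ-cong (cong natℚ (ℕ.m+[n∸m]≡n j≤k))))
    (0≤⇒≤ (0≤nat (k ℕ.∸ j)) (solve 2 (λ a b → (a :+ b) :- a := b) refl (nat j) (nat (k ℕ.∸ j))))

  -- Sends 0 to 0, matching the convention `x ÷ 0 = 0` of the division by which the given Laplacian
  -- is defined.
  recip : ℕ → Carrier
  recip zero      = 0#
  recip n@(suc _) = fromℚ (+ 1 ℚ./ n)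

  infixl 7 _÷_
  _÷_ : Carrier → ℕ → Carrier
  x ÷ n = recip n * x

  ÷-zero : ∀ x → x ÷ 0 ≈ 0#
  ÷-zero x = zeroˡ x

  0≤recip : ∀ n → 0# ≤ recip n
  0≤recip zero    = ≤-refl
  0≤recip (suc n) = fromℚ-nonNeg (ℚ.<⇒≤ (0<1/n n))

  nat*recip : ∀ n → nat (suc n) * recip (suc n) ≈ fromℚ 1ℚ
  nat*recip n = trans (sym (*-homo (natℚ (suc n)) (+ 1 ℚ./ suc n))) (fromℚ-cong (natℚ*1/n n))

  nat*recip* : ∀ n c → nat (suc n) * (recip (suc n) * c) ≈ c
  nat*recip* n c = begin
    nat (suc n) * (recip (suc n) * c)  ≈⟨ solve 3 (λ a b c → a :* (b :* c) := (a :* b) :* c) refl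
                                            (nat (suc n)) (recip (suc n)) c ⟩
    (nat (suc n) * recip (suc n)) * c  ≈⟨ *-cong (nat*recip n) refl ⟩
    fromℚ 1ℚ * c                       ≈⟨ solve 1 (λ a → con 1ℚ :* a := a) refl c ⟩
    c                                  ∎

  fromℚ÷-pos : ∀ {q k} → 0ℚ ℚ.< q → 1 ℕ.≤ k → ¬ (fromℚ q ÷ k ≤ 0#)
  fromℚ÷-pos {k = suc k} 0<q _ = 0<* (fromℚ-pos (0<1/n k)) (fromℚ-pos 0<q)

  nat*÷ : ∀ {k} x → 1 ℕ.≤ k → nat k * (x ÷ k) ≈ x
  nat*÷ {suc k} x _ = nat*recip* k x

  -- With walks of length at most 3D, the constant 72/100 = 3² · 8 · 1/100 has to be less than 1.
  1/100÷-small : ∀ d D → 1 ℕ.≤ d ℕ.* D ^ 2 →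
    (nat (3 ℕ.* D) * nat (3 ℕ.* D)) * (nat d * (fromℚ 8ℚ * (fromℚ 1/100 ÷ (d ℕ.* D ^ 2)))) ≤ fromℚ 72/100
  1/100÷-small d D 1≤ = ≈⇒≤ (begin
    (nat (3 ℕ.* D) * nat (3 ℕ.* D)) * (nat d * (fromℚ 8ℚ * θ))
      ≈⟨ *-cong (*-cong (nat-* 3 D) (nat-* 3 D)) refl ⟩
    ((nat 3 * nat D) * (nat 3 * nat D)) * (nat d * (fromℚ 8ℚ * θ))
      ≈⟨ solve 3 (λ D d t → ((con (natℚ 3) :* D) :* (con (natℚ 3) :* D)) :* (d :* (con 8ℚ :* t))
           := con 72ℚ :* ((d :* (D :* (D :* con 1ℚ))) :* t)) refl (nat D) (nat d) θ ⟩
    fromℚ 72ℚ * ((nat d * (nat D * (nat D * fromℚ 1ℚ))) * θ)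
      ≈⟨ *-cong refl (*-cong (sym nat-dD²) refl) ⟩
    fromℚ 72ℚ * (nat (d ℕ.* D ^ 2) * θ)
      ≈⟨ *-cong refl (nat*÷ (fromℚ 1/100) 1≤) ⟩
    fromℚ 72ℚ * fromℚ 1/100
      ≈⟨ *-homo 72ℚ 1/100 ⟨
    fromℚ 72/100 ∎)
    where
    72ℚ = + 72 ℚ./ 1
    θ = fromℚ 1/100 ÷ (d ℕ.* D ^ 2)
    nat-dD² : nat (d ℕ.* D ^ 2) ≈ nat d * (nat D * (nat D * fromℚ 1ℚ))
    nat-dD² = trans (nat-* d (D ^ 2)) (*-cong refl (trans (nat-* D (D ^ 1))
      (*-cong refl (nat-* D 1))))

  -- Finite sums.

  ∑ : ∀ {A : Set} → List A → (A → Carrier) → Carrier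
  ∑ xs f = foldr (λ a r → f a + r) 0# xs

  module _ {A : Set} where

    ∑-cong : ∀ xs {f g : A → Carrier} → (∀ {a} → a ∈ xs → f a ≈ g a) → ∑ xs f ≈ ∑ xs g
    ∑-cong []       h = refl
    ∑-cong (x ∷ xs) h = +-cong (h (Any.here ≡.refl)) (∑-cong xs (h ∘ Any.there))

    ∑-zero : ∀ xs {f : A → Carrier} → (∀ {a} → a ∈ xs → f a ≈ 0#) → ∑ xs f ≈ 0#
    ∑-zero []       h = refl
    ∑-zero (x ∷ xs) h = trans (+-cong (h (Any.here ≡.refl)) (∑-zero xs (h ∘ Any.there))) (+-identityˡ 0#)

    ∑-linear : ∀ xs (f g : A → Carrier) c → ∑ xs (λ a → f a + c * g a) ≈ ∑ xs f + c * ∑ xs g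
    ∑-linear []       f g c = sym (trans (+-identityˡ (c * 0#)) (zeroʳ c))
    ∑-linear (x ∷ xs) f g c = trans (+-cong refl (∑-linear xs f g c))
      (solve 5 (λ a b c d e → (a :+ e :* b) :+ (c :+ e :* d) := (a :+ c) :+ e :* (b :+ d)) refl
        (f x) (g x) (∑ xs f) (∑ xs g) c)

    ∑-const : ∀ xs c → ∑ {A} xs (λ _ → c) ≈ nat (length xs) * c
    ∑-const []       c = sym (trans (*-cong 0-homo refl) (zeroˡ c))
    ∑-const (x ∷ xs) c = begin
      c + ∑ xs (λ _ → c)           ≈⟨ +-cong refl (∑-const xs c) ⟩
      c + nat (length xs) * c      ≈⟨ solve 2 (λ c n → c :+ n :* c := (con 1ℚ :+ n) :* c) refl
                                        c (nat (length xs)) ⟩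
      (fromℚ 1ℚ + nat (length xs)) * c ≈⟨ *-cong (sym (nat-suc (length xs))) refl ⟩
      nat (suc (length xs)) * c    ∎

    ∑-nonNeg : ∀ xs {f : A → Carrier} → (∀ {a} → a ∈ xs → 0# ≤ f a) → 0# ≤ ∑ xs f
    ∑-nonNeg []       h = ≤-refl
    ∑-nonNeg (x ∷ xs) h = 0≤+ (h (Any.here ≡.refl)) (∑-nonNeg xs (h ∘ Any.there))

    term≤∑ : ∀ xs {f : A → Carrier} {a} → (∀ {b} → b ∈ xs → 0# ≤ f b) → a ∈ xs → f a ≤ ∑ xs f
    term≤∑ (x ∷ xs) {f} h (Any.here ≡.refl) = ≤-respˡ-≈ (+-identityʳ (f x))
      (+-mono-≤ ≤-refl (∑-nonNeg xs (h ∘ Any.there)))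
    term≤∑ (x ∷ xs) {f} {a} h (Any.there a∈xs) = ≤-respˡ-≈ (+-identityˡ (f a))
      (+-mono-≤ (h (Any.here ≡.refl)) (term≤∑ xs (h ∘ Any.there) a∈xs))

-- Graphs over a stable ordered ring

degree≤maxDegree : ∀ {n} (G : Graph n) x → degree G x ℕ.≤ maxDegree G
degree≤maxDegree G x = All.lookup (xs≤max 0 (List.map (degree G) (allFin _)))
  (∈-map⁺ (degree G) (∈-allFin x))

walk⇒neighbour : ∀ {n} {G : Graph n} {x y k} → x ≢ y → Walk G x y k → ∃ λ z → Graph._∼_ G x z
walk⇒neighbour x≢y here            = ⊥-elim (x≢y ≡.refl)
walk⇒neighbour x≢y (step x∼z walk) = _ , x∼z

walk⇒1≤k : ∀ {n} {G : Graph n} {x y k} → x ≢ y → Walk G x y k → 1 ℕ.≤ k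
walk⇒1≤k x≢y here       = ⊥-elim (x≢y ≡.refl)
walk⇒1≤k x≢y (step _ _) = s≤s z≤n

-- Graphs on at most one vertex have no edges, so any colouring shows them to be bipartite.
2≤n : ∀ {n} (G : Graph n) → ¬ Bipartite G → 2 ℕ.≤ n
2≤n {zero}        G ¬bip = ⊥-elim (¬bip ((λ ()) , λ ()))
2≤n {suc zero}    G ¬bip = ⊥-elim (¬bip ((λ _ → false) , λ { zero zero e → ⊥-elim (Graph.∼-irrefl G ≡.refl e) }))
2≤n {suc (suc n)} G ¬bip = s≤s (s≤s z≤n)

module _ {m : ℕ} (G : Graph (suc (suc m))) (connected : Connected G) where

  neighbour : ∀ x → ∃ λ y → Graph._∼_ G x y
  neighbour zero    = walk⇒neighbour {G = G} (λ ()) (proj₂ (connected zero (suc zero)))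
  neighbour (suc i) = walk⇒neighbour {G = G} (λ ()) (proj₂ (connected (suc i) zero))

  1≤diameter : ∀ {D} → IsDiameter G D → 1 ℕ.≤ D
  1≤diameter (dist , _) with k , (walk , _) , k≤D ← dist zero (suc zero) =
    ℕ.≤-trans (walk⇒1≤k {G = G} (λ ()) walk) k≤D

odd : ℕ → Bool
odd zero    = false
odd (suc k) = not (odd k)

module GraphAnalysis (K : StableOrderedRing) {n : ℕ} (G : Graph n) where

  open OrderedRingProperties K
  open Sol using (solve; con; _:+_; _:*_; _:-_; :-_; _:=_)
  open import Relation.Binary.Reasoning.Setoid setoid
  open Graph G using (_∼_; _∼?_; ∼-sym; ∼-irrefl)

  -- Averages over neighbours, the Laplacian and `Γ`.

  avg : Fin n → (Fin n → Carrier) → Carrier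
  avg x h = ∑ (neighbours G x) h ÷ degree G x

  Δ : (Fin n → Carrier) → Fin n → Carrier
  Δ f x = avg x (λ y → f y - f x)

  Γ : (f g : Fin n → Carrier) → Fin n → Carrier
  Γ f g x = (Δ (λ y → f y * g y) x - g x * Δ f x - f x * Δ g x) ÷ 2

  Γ₂ : (f g : Fin n → Carrier) → Fin n → Carrier
  Γ₂ f g x = (Δ (Γ f g) x - Γ g (Δ f) x - Γ f (Δ g) x) ÷ 2

  -- Matching on the given vertex exposes `n` as a successor.
  ¬¬argmax-inhabited : (F : Fin n → Carrier) → Fin n → ¬ ¬ (∃ λ x → ∀ y → F y ≤ F x)
  ¬¬argmax-inhabited F zero    = ¬¬argmax F
  ¬¬argmax-inhabited F (suc _) = ¬¬argmax F

  ∈-neighbours⁻ : ∀ {x y} → y ∈ neighbours G x → x ∼ y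
  ∈-neighbours⁻ {x} y∈ = proj₂ (∈-filter⁻ (x ∼?_) {xs = allFin n} y∈)

  ∈-neighbours⁺ : ∀ {x y} → x ∼ y → y ∈ neighbours G x
  ∈-neighbours⁺ {x} {y} x∼y = ∈-filter⁺ (x ∼?_) (∈-allFin y) x∼y

  avg-cong : ∀ x {h k} → (∀ {y} → x ∼ y → h y ≈ k y) → avg x h ≈ avg x k
  avg-cong x e = *-cong refl (∑-cong (neighbours G x) (e ∘ ∈-neighbours⁻))

  avg-linear : ∀ x h k c → avg x (λ y → h y + c * k y) ≈ avg x h + c * avg x k
  avg-linear x h k c = begin
    r * ∑ ns (λ y → h y + c * k y)     ≈⟨ *-cong refl (∑-linear ns h k c) ⟩
    r * (∑ ns h + c * ∑ ns k)          ≈⟨ solve 4 (λ r a c b → r :* (a :+ c :* b) := r :* a :+ c :* (r :* b))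
                                            refl r (∑ ns h) c (∑ ns k) ⟩
    r * ∑ ns h + c * (r * ∑ ns k)      ∎
    where
    r  = recip (degree G x)
    ns = neighbours G x

  avg-* : ∀ x k c → avg x (λ y → c * k y) ≈ c * avg x k
  avg-* x k c = begin
    -- Writing `c` as 1 + (c - 1) makes this a case of `avg-linear`.
    avg x (λ y → c * k y)              ≈⟨ avg-cong x (λ {y} _ → solve 2 (λ c a → c :* a := a :+ (c :- con 1ℚ) :* a)
                                            refl c (k y)) ⟩
    avg x (λ y → k y + (c - fromℚ 1ℚ) * k y) ≈⟨ avg-linear x k k (c - fromℚ 1ℚ) ⟩
    avg x k + (c - fromℚ 1ℚ) * avg x k ≈⟨ solve 2 (λ c a → a :+ (c :- con 1ℚ) :* a := c :* a)
                                            refl c (avg x k) ⟩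
    c * avg x k                        ∎

  avg-nonNeg : ∀ x {h} → (∀ {y} → x ∼ y → 0# ≤ h y) → 0# ≤ avg x h
  avg-nonNeg x 0≤h = 0≤* (0≤recip (degree G x)) (∑-nonNeg (neighbours G x) (0≤h ∘ ∈-neighbours⁻))

  degree*avg : ∀ {x y} → x ∼ y → ∀ h → nat (degree G x) * avg x h ≈ ∑ (neighbours G x) h
  degree*avg {x} x∼y h = go (neighbours G x) (∈-neighbours⁺ x∼y)
    where
    -- Membership excludes the empty list, so the length is a successor, whose `recip` is a genuine
    -- inverse.
    go : ∀ ns {y} → y ∈ ns → nat (length ns) * (recip (length ns) * ∑ ns h) ≈ ∑ ns h
    go ns@(_ ∷ ms) _ = nat*recip* (length ms) (∑ ns h)

  term≤degree*avg : ∀ {x y} h → (∀ {z} → x ∼ z → 0# ≤ h z) → x ∼ y → h y ≤ nat (degree G x) * avg x h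
  term≤degree*avg {x} h 0≤h x∼y = ≤-respʳ-≈ (sym (degree*avg x∼y h))
    (term≤∑ (neighbours G x) (0≤h ∘ ∈-neighbours⁻) (∈-neighbours⁺ x∼y))

  avg-const : ∀ {x y} → x ∼ y → ∀ c → avg x (λ _ → c) ≈ c
  avg-const {x} x∼y c = begin
    recip (degree G x) * ∑ (neighbours G x) (λ _ → c)  ≈⟨ *-cong refl (∑-const (neighbours G x) c) ⟩
    recip (degree G x) * (nat (degree G x) * c)        ≈⟨ solve 3 (λ r m c → r :* (m :* c) := m :* (r :* c))
                                                            refl _ _ c ⟩
    nat (degree G x) * (recip (degree G x) * c)        ≈⟨ go (neighbours G x) (∈-neighbours⁺ x∼y) ⟩
    c                                                  ∎
    where
    go : ∀ ns {y} → y ∈ ns → nat (length ns) * (recip (length ns) * c) ≈ c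
    go (_ ∷ ms) _ = nat*recip* (length ms) c

  -- The maximum principle: no neighbour exceeds the value at `x`, so the negated differences have a
  -- nonnegative average.
  Δ-max : ∀ {h : Fin n → Carrier} {x} → (∀ y → h y ≤ h x) → 0# ≤ - Δ h x
  Δ-max {h} {x} max = ≤-respʳ-≈
    (trans (avg-cong x (λ {y} _ → solve 2 (λ a b → b :- a := (:- con 1ℚ) :* (a :- b)) refl (h y) (h x)))
      (trans (avg-* x (λ y → h y - h x) (- fromℚ 1ℚ))
        (solve 1 (λ a → (:- con 1ℚ) :* a := :- a) refl (Δ h x))))
    (avg-nonNeg x λ {y} _ → x≤y⇒0≤y-x (max y))

  minus-cong : ∀ {a b c d} → a ≈ b → c ≈ d → a - c ≈ b - d
  minus-cong h k = +-cong h (-‿cong k)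

  -- A product of differences is the difference of the products minus `g x` times the difference of
  -- `f` and `f x` times that of `g`; these two factors are constant under the average. The outer
  -- `½` is `recip 2`.
  Γ≈ : ∀ f g x → Γ f g x ≈ fromℚ ½ * avg x (λ y → (f y - f x) * (g y - g x))
  Γ≈ f g x = *-cong refl (sym (begin
    avg x (λ y → (f y - f x) * (g y - g x))
      ≈⟨ avg-cong x (λ {y} _ → solve 4 (λ a b c d → (a :- b) :* (c :- d) :=
           ((a :* c :- b :* d) :+ (:- d) :* (a :- b)) :+ (:- b) :* (c :- d))
           refl (f y) (f x) (g y) (g x)) ⟩
    avg x (λ y → ((f y * g y - f x * g x) + (- g x) * (f y - f x)) + (- f x) * (g y - g x))
      ≈⟨ avg-linear x _ (λ y → g y - g x) (- f x) ⟩
    avg x (λ y → (f y * g y - f x * g x) + (- g x) * (f y - f x)) + (- f x) * Δ g x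
      ≈⟨ +-cong (avg-linear x (λ y → f y * g y - f x * g x) (λ y → f y - f x) (- g x)) refl ⟩
    (Δ (λ y → f y * g y) x + (- g x) * Δ f x) + (- f x) * Δ g x
      ≈⟨ solve 5 (λ p q r s t → (p :+ (:- q) :* r) :+ (:- s) :* t := (p :- q :* r) :- s :* t)
           refl (Δ (λ y → f y * g y) x) (g x) (Δ f x) (f x) (Δ g x) ⟩
    Δ (λ y → f y * g y) x - g x * Δ f x - f x * Δ g x ∎))

  -- Transfers CD(0,∞) and the spectrum from given operations to those of K.  The
  -- operations are parameters so that those of Defs can be passed in literally:
  -- comparing compound terms in ℝ by unfolding is infeasible.
  module Agreement (∑ᴳ : List (Fin n) → (Fin n → Carrier) → Carrier)
    (_⊕_ _·_ _⊖_ : Carrier → Carrier → Carrier) (neg : Carrier → Carrier) (_⊘_ : Carrier → ℕ → Carrier)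
    (rat : ℚ → Carrier) (Δᴳ : (Fin n → Carrier) → Fin n → Carrier)
    (Γᴳ Γ₂ᴳ : (f g : Fin n → Carrier) → Fin n → Carrier)
    (∑-def : ∀ xs f → ∑ᴳ xs f ≈ foldr (λ a r → f a ⊕ r) (rat 0ℚ) xs)
    (⊕≈+ : ∀ x y → x ⊕ y ≈ x + y) (·≈* : ∀ x y → x · y ≈ x * y) (neg≈- : ∀ x → neg x ≈ - x)
    (rat≈fromℚ : ∀ q → rat q ≈ fromℚ q) (⊖-def : ∀ x y → x ⊖ y ≈ x ⊕ neg y)
    (⊘-zero : ∀ x → x ⊘ 0 ≈ rat 0ℚ) (⊘-suc : ∀ x k → x ⊘ suc k ≈ rat (+ 1 ℚ./ suc k) · x)
    (Δ-def : ∀ f x → Δᴳ f x ≈ ∑ᴳ (neighbours G x) (λ y → f y ⊖ f x) ⊘ degree G x)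
    (Γ-def : ∀ f g x → Γᴳ f g x ≈ ((Δᴳ (λ y → f y · g y) x ⊖ (g x · Δᴳ f x)) ⊖ (f x · Δᴳ g x)) ⊘ 2)
    (Γ₂-def : ∀ f g x → Γ₂ᴳ f g x ≈ ((Δᴳ (Γᴳ f g) x ⊖ Γᴳ g (Δᴳ f) x) ⊖ Γᴳ f (Δᴳ g) x) ⊘ 2) where

    ∑ᴳ≈∑ : ∀ xs {f g} → (∀ x → f x ≈ g x) → ∑ᴳ xs f ≈ ∑ xs g
    ∑ᴳ≈∑ xs {f} {g} e = trans (∑-def xs f) (go xs)
      where
      go : ∀ xs → foldr (λ a r → f a ⊕ r) (rat 0ℚ) xs ≈ ∑ xs g
      go []       = trans (rat≈fromℚ 0ℚ) 0-homo
      go (x ∷ xs) = trans (⊕≈+ _ _) (+-cong (e x) (go xs))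

    ⊖≈- : ∀ x y → x ⊖ y ≈ x - y
    ⊖≈- x y = trans (⊖-def x y) (trans (⊕≈+ x (neg y)) (+-cong refl (neg≈- y)))

    ⊘≈÷ : ∀ x k → x ⊘ k ≈ x ÷ k
    ⊘≈÷ x zero    = trans (⊘-zero x) (trans (rat≈fromℚ 0ℚ) (trans 0-homo (sym (÷-zero x))))
    ⊘≈÷ x (suc k) = trans (⊘-suc x k) (trans (·≈* _ x) (*-cong (rat≈fromℚ _) refl))

    ⊖-cong : ∀ {a b c d} → a ≈ b → c ≈ d → a ⊖ c ≈ b - d
    ⊖-cong h k = trans (⊖≈- _ _) (minus-cong h k)

    ·-cong : ∀ {a b c d} → a ≈ b → c ≈ d → a · c ≈ b * d
    ·-cong h k = trans (·≈* _ _) (*-cong h k)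

    ⊘-cong : ∀ {a b} k → a ≈ b → a ⊘ k ≈ b ÷ k
    ⊘-cong k h = trans (⊘≈÷ _ k) (*-cong refl h)

    Δᴳ≈Δ : ∀ {f g} → (∀ x → f x ≈ g x) → ∀ x → Δᴳ f x ≈ Δ g x
    Δᴳ≈Δ {f} e x = trans (Δ-def f x) (⊘-cong (degree G x) (∑ᴳ≈∑ (neighbours G x) λ y → ⊖-cong (e y) (e x)))

    Γᴳ≈Γ : ∀ {f g f′ g′} → (∀ x → f x ≈ f′ x) → (∀ x → g x ≈ g′ x) → ∀ x → Γᴳ f g x ≈ Γ f′ g′ x
    Γᴳ≈Γ {f} {g} e e′ x = trans (Γ-def f g x) (⊘-cong 2 (⊖-cong
      (⊖-cong (Δᴳ≈Δ (λ y → ·-cong (e y) (e′ y)) x) (·-cong (e′ x) (Δᴳ≈Δ e x))) (·-cong (e x) (Δᴳ≈Δ e′ x))))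

    Γ₂ᴳ≈Γ₂ : ∀ f g x → Γ₂ᴳ f g x ≈ Γ₂ f g x
    Γ₂ᴳ≈Γ₂ f g x = trans (Γ₂-def f g x) (⊘-cong 2 (⊖-cong
      (⊖-cong (Δᴳ≈Δ (Γᴳ≈Γ e e′) x) (Γᴳ≈Γ e′ (Δᴳ≈Δ e) x)) (Γᴳ≈Γ e (Δᴳ≈Δ e′) x)))
      where
      e : ∀ x → f x ≈ f x
      e _ = refl
      e′ : ∀ x → g x ≈ g x
      e′ _ = refl

  -- The operator Δˢ f x = avg x (λ y → s * f y - f x) is the Laplacian twisted
  -- by a sign s.  Its eigenfunctions are those of Δ, with 2 - μ for μ if s = - 1.
  SignedEigen : (s μ : Carrier) (f : Fin n → Carrier) → Set
  SignedEigen s μ f = ∀ x → avg x (λ y → s * f y - f x) ≈ - (μ * f x)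

  -- The Bochner inequality for the signed Laplacian.

  module Signed (cd : ∀ g x → 0# ≤ Γ₂ g g x) (triangle-free : TriangleFree G)
    (s : Carrier) (s*s≈1 : s * s ≈ fromℚ 1ℚ)
    (μ : Carrier) (f : Fin n → Carrier) (eigen : SignedEigen s μ f) where

    -- The ring solver does not know that `s * s` is 1. Identities depending on it are solved with
    -- an explicit multiple of `s * s - 1`, with cofactor `W`, which is then dropped.
    ≈-mod-sign : ∀ {X Y} W → X ≈ Y + (s * s - fromℚ 1ℚ) * W → X ≈ Y
    ≈-mod-sign {X} {Y} W e = begin
      X                                    ≈⟨ e ⟩
      Y + (s * s - fromℚ 1ℚ) * W           ≈⟨ +-cong refl (*-cong (+-cong s*s≈1 refl) refl) ⟩
      Y + (fromℚ 1ℚ - fromℚ 1ℚ) * W        ≈⟨ solve 2 (λ Y W → Y :+ (con 1ℚ :- con 1ℚ) :* W := Y) refl Y W ⟩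
      Y                                    ∎

    E : Fin n → Carrier
    E x = avg x (λ y → (s * f y - f x) * (s * f y - f x))

    0≤E : ∀ x → 0# ≤ E x
    0≤E x = avg-nonNeg x (λ {y} _ → 0≤x*x (s * f y - f x))

    -- As G is triangle-free, multiplying f by s on the sphere around x turns Δˢ
    -- into Δ at x and at its neighbours.
    module _ (x : Fin n) where

      twist′ : ∀ {y} → Dec (x ∼ y) → Carrier
      twist′ {y} (yes _) = s * f y
      twist′ {y} (no _)  = f y

      g : Fin n → Carrier
      g y = twist′ {y} (x ∼? y)

      g-near : ∀ {y} → x ∼ y → g y ≈ s * f y
      g-near {y} x∼y with x ∼? y
      ... | yes _  = refl
      ... | no x≁y = ⊥-elim (x≁y x∼y)

      g-far : ∀ {y} → ¬ (x ∼ y) → g y ≈ f y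
      g-far {y} x≁y with x ∼? y
      ... | yes x∼y = ⊥-elim (x≁y x∼y)
      ... | no _    = refl

      g-centre : g x ≈ f x
      g-centre = g-far (∼-irrefl ≡.refl)

      -- Triangle-freeness enters here: a neighbour of a neighbour of `x` is never adjacent to `x`,
      -- so it keeps its value.
      g-second : ∀ {y z} → x ∼ y → y ∼ z → g z ≈ f z
      g-second {y} {z} x∼y y∼z = g-far λ x∼z → triangle-free x y z x∼y y∼z (∼-sym x∼z)

      Γ-centre : Γ g g x ≈ fromℚ ½ * E x
      Γ-centre = trans (Γ≈ g g x) (*-cong refl (avg-cong x λ x∼y →
        let e = minus-cong (g-near x∼y) g-centre in *-cong e e))

      -- Here `y` carries the factor `s` and its neighbours do not. The difference `f z - s * f y`
      -- is `s` times the signed one, so the squares agree.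
      Γ-near : ∀ {y} → x ∼ y → Γ g g y ≈ fromℚ ½ * E y
      Γ-near {y} x∼y = trans (Γ≈ g g y) (*-cong refl (avg-cong y λ {z} y∼z →
        let e = minus-cong (g-second x∼y y∼z) (g-near x∼y) in
        trans (*-cong e e) (≈-mod-sign (f y * f y - f z * f z)
          (solve 3 (λ s a b → (b :- s :* a) :* (b :- s :* a) :=
              (s :* b :- a) :* (s :* b :- a) :+ (s :* s :- con 1ℚ) :* (a :* a :- b :* b))
            refl s (f y) (f z)))))

      Δ-centre : Δ g x ≈ - (μ * f x)
      Δ-centre = trans (avg-cong x λ x∼y → minus-cong (g-near x∼y) g-centre) (eigen x)

      Δ-near : ∀ {y} → x ∼ y → Δ g y ≈ - (μ * (s * f y))
      Δ-near {y} x∼y = begin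
        Δ g y                              ≈⟨ avg-cong y (λ {z} y∼z →
          trans (minus-cong (g-second x∼y y∼z) (g-near x∼y)) (≈-mod-sign (- f z)
            (solve 3 (λ s a b → b :- s :* a := s :* (s :* b :- a) :+ (s :* s :- con 1ℚ) :* (:- b))
              refl s (f y) (f z)))) ⟩
        avg y (λ z → s * (s * f z - f y))  ≈⟨ avg-* y (λ z → s * f z - f y) s ⟩
        s * avg y (λ z → s * f z - f y)    ≈⟨ *-cong refl (eigen y) ⟩
        s * - (μ * f y)                    ≈⟨ solve 3 (λ s m a → s :* (:- (m :* a)) := :- (m :* (s :* a)))
                                                refl s μ (f y) ⟩
        - (μ * (s * f y))                  ∎

      Γ-Δ : Γ g (Δ g) x ≈ fromℚ ½ * (- μ * E x)
      Γ-Δ = trans (Γ≈ g (Δ g) x) (*-cong refl (trans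
        (avg-cong x λ {y} x∼y → trans
          (*-cong (minus-cong (g-near x∼y) g-centre) (minus-cong (Δ-near x∼y) Δ-centre))
          (solve 3 (λ a b m → (a :- b) :* (:- (m :* a) :- :- (m :* b)) :=
              (:- m) :* ((a :- b) :* (a :- b))) refl (s * f y) (f x) μ))
        (avg-* x (λ y → (s * f y - f x) * (s * f y - f x)) (- μ))))

      -- `Γ₂ g g x` involves only `Γ g g` and `Δ g` at `x` and its neighbours, where they are half
      -- of `E` and `- μ` times `g`. The curvature condition multiplied by 4 is the claim.
      bochner : 0# ≤ avg x (λ y → E y - E x) + fromℚ 2ℚ * (μ * E x)
      bochner = ≤-respʳ-≈ eq (0≤* (fromℚ-nonNeg (ℚ.nonNegative⁻¹ 4ℚ)) (cd g x))
        where
        A = avg x (λ y → E y - E x)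
        ΔΓ : Δ (Γ g g) x ≈ fromℚ ½ * A
        ΔΓ = trans (avg-cong x λ {y} x∼y → trans (minus-cong (Γ-near x∼y) Γ-centre)
               (solve 2 (λ a b → con ½ :* a :- con ½ :* b := con ½ :* (a :- b)) refl (E y) (E x)))
             (avg-* x (λ y → E y - E x) (fromℚ ½))
        eq : fromℚ 4ℚ * Γ₂ g g x ≈ A + fromℚ 2ℚ * (μ * E x)
        eq = begin
          fromℚ 4ℚ * Γ₂ g g x
            ≈⟨ *-cong refl (*-cong refl (minus-cong (minus-cong ΔΓ Γ-Δ) Γ-Δ)) ⟩
          fromℚ 4ℚ * (fromℚ ½ * (fromℚ ½ * A - fromℚ ½ * (- μ * E x) - fromℚ ½ * (- μ * E x)))
            ≈⟨ solve 3 (λ A m e → con 4ℚ :* (con ½ :* (con ½ :* A :- con ½ :* ((:- m) :* e) :- con ½ :* ((:- m) :* e)))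
                 := A :+ con 2ℚ :* (m :* e)) refl A μ (E x) ⟩
          A + fromℚ 2ℚ * (μ * E x) ∎

    -- Δ(f²) = 2Γ(f) + 2 f Δf, with E playing the role of 2Γ(f).
    Δ-square : ∀ x → avg x (λ y → f y * f y - f x * f x) ≈ E x - fromℚ 2ℚ * (μ * (f x * f x))
    Δ-square x = begin
      avg x (λ y → f y * f y - f x * f x)
        ≈⟨ avg-cong x (λ {y} _ → ≈-mod-sign (- (f y * f y)) (solve 3 (λ s a b →
             b :* b :- a :* a := (((s :* b :- a) :* (s :* b :- a)) :+ (con 2ℚ :* a) :* (s :* b :- a))
               :+ (s :* s :- con 1ℚ) :* (:- (b :* b))) refl s (f x) (f y))) ⟩
      avg x (λ y → (s * f y - f x) * (s * f y - f x) + (fromℚ 2ℚ * f x) * (s * f y - f x))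
        ≈⟨ avg-linear x _ _ (fromℚ 2ℚ * f x) ⟩
      E x + (fromℚ 2ℚ * f x) * avg x (λ y → s * f y - f x)
        ≈⟨ +-cong refl (*-cong refl (eigen x)) ⟩
      E x + (fromℚ 2ℚ * f x) * - (μ * f x)
        ≈⟨ solve 3 (λ e a m → e :+ (con 2ℚ :* a) :* (:- (m :* a)) := e :- con 2ℚ :* (m :* (a :* a)))
             refl (E x) (f x) μ ⟩
      E x - fromℚ 2ℚ * (μ * (f x * f x)) ∎

    -- By `Δ-square`, 2μf² = E - Δ(f²) at `x`, and at a maximum of f² both `E` and -Δ(f²) are
    -- nonnegative.
    eigenvalue-nonNeg : ∀ {x} → (∀ y → f y * f y ≤ f x * f x) → ¬ (f x * f x ≤ 0#) → 0# ≤ μ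
    eigenvalue-nonNeg {x} max fx≢0 = *-cancel-0≤ fx≢0 (≤-respʳ-≈
      (trans (*-cong refl (+-cong refl (-‿cong (Δ-square x))))
        (solve 3 (λ e a m → con ½ :* (e :+ :- (e :- con 2ℚ :* (m :* a))) := a :* m) refl
          (E x) (f x * f x) μ))
      (0≤* (fromℚ-nonNeg (ℚ.nonNegative⁻¹ ½)) (0≤+ (0≤E x) (Δ-max max))))

    -- The gradient estimate by the maximum principle.

    module Gradient (θ : Carrier) (0<θ : ¬ (θ ≤ 0#)) (μ≤θ : μ ≤ θ) where

      0≤θ : 0# ≤ θ
      0≤θ = ≰⇒≥ 0<θ

      F : Fin n → Carrier
      F x = E x + (fromℚ 4ℚ * θ) * (f x * f x)

      Δ-F : ∀ x → Δ F x ≈ avg x (λ y → E y - E x)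
                        + (fromℚ 4ℚ * θ) * (E x - fromℚ 2ℚ * (μ * (f x * f x)))
      Δ-F x = begin
        Δ F x
          ≈⟨ avg-cong x (λ {y} _ → solve 5 (λ a b c d t → (a :+ t :* b) :- (c :+ t :* d) :=
               (a :- c) :+ t :* (b :- d)) refl (E y) (f y * f y) (E x) (f x * f x) (fromℚ 4ℚ * θ)) ⟩
        avg x (λ y → (E y - E x) + (fromℚ 4ℚ * θ) * (f y * f y - f x * f x))
          ≈⟨ avg-linear x _ _ (fromℚ 4ℚ * θ) ⟩
        avg x (λ y → E y - E x) + (fromℚ 4ℚ * θ) * avg x (λ y → f y * f y - f x * f x)
          ≈⟨ +-cong refl (*-cong refl (Δ-square x)) ⟩
        avg x (λ y → E y - E x) + (fromℚ 4ℚ * θ) * (E x - fromℚ 2ℚ * (μ * (f x * f x))) ∎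

      -- At a maximum of `F` one has ΔF ≤ 0, while `bochner` bounds ΔE below by -2μE. Together they
      -- give 0 ≤ 2μE - 4θE + 8θμf², and raising `μ` to `θ` leaves 0 ≤ 2θ(4θf² - E).
      E≤-at-max : ∀ {x} → (∀ y → F y ≤ F x) → E x ≤ (fromℚ 4ℚ * θ) * (f x * f x)
      E≤-at-max {x} max = 0≤y-x⇒x≤y (*-cancel-0≤ 0<θ (≤-respʳ-≈ eq
        (0≤* (fromℚ-nonNeg (ℚ.nonNegative⁻¹ ½))
          (0≤+ (0≤+ (0≤+ (bochner x) (Δ-max max)) (0≤* 0≤2 (0≤* 0≤θ-μ (0≤E x))))
               (0≤* 0≤8 (0≤* 0≤θ (0≤* 0≤θ-μ (0≤x*x (f x)))))))))
        where
        0≤2 = fromℚ-nonNeg (ℚ.nonNegative⁻¹ 2ℚ)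
        0≤8 = fromℚ-nonNeg (ℚ.nonNegative⁻¹ 8ℚ)
        0≤θ-μ = x≤y⇒0≤y-x μ≤θ
        eq = trans (*-cong refl (+-cong (+-cong (+-cong refl (-‿cong (Δ-F x))) refl) refl))
          (solve 5 (λ A e a m t → con ½ :* ((((A :+ con 2ℚ :* (m :* e))
              :+ :- (A :+ (con 4ℚ :* t) :* (e :- con 2ℚ :* (m :* (a :* a)))))
              :+ con 2ℚ :* ((t :- m) :* e)) :+ con 8ℚ :* (t :* ((t :- m) :* (a :* a))))
            := t :* ((con 4ℚ :* t) :* (a :* a) :- e))
            refl (avg x (λ y → E y - E x)) (E x) (f x) μ θ)

      -- The maximum `x` of `F` need not be `x₀`. As `E x` is at most 4θf(x)², the values of `F`
      -- never exceed 8θf(x)², and f(x)² is at most f(x₀)².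
      E≤ : ∀ {x₀} → (∀ y → f y * f y ≤ f x₀ * f x₀) → ∀ y → E y ≤ (fromℚ 8ℚ * θ) * (f x₀ * f x₀)
      E≤ {x₀} max y = ≤-stable λ ≰ → ¬¬argmax-inhabited F y λ (x , maxF) → ≰ (
        ≤-trans (0≤⇒≤ (0≤* (0≤* 0≤4 0≤θ) (0≤x*x (f y)))
                  (solve 2 (λ e t → (e :+ t) :- e := t) refl (E y) ((fromℚ 4ℚ * θ) * (f y * f y))))
        (≤-trans (maxF y)
        (≤-trans (+-mono-≤ (E≤-at-max maxF) ≤-refl)
        (≤-trans (≈⇒≤ (solve 2 (λ t a → (con 4ℚ :* t) :* a :+ (con 4ℚ :* t) :* a := (con 8ℚ :* t) :* a)
                   refl θ (f x * f x)))
          (*-monoʳ-≤ (0≤* 0≤8 0≤θ) (max x))))))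
        where
        0≤4 = fromℚ-nonNeg (ℚ.nonNegative⁻¹ 4ℚ)
        0≤8 = fromℚ-nonNeg (ℚ.nonNegative⁻¹ 8ℚ)

      -- Variation of `f` along walks.

      module _ (x₀ : Fin n) (max : ∀ y → f y * f y ≤ f x₀ * f x₀)
        (d≤ : ∀ x → degree G x ℕ.≤ maxDegree G) (L : ℕ)
        (θ-small : (nat L * nat L) * (nat (maxDegree G) * (fromℚ 8ℚ * θ)) ≤ fromℚ 72/100) where

        private
          M = f x₀
          -- The sum of 72/100 from `θ-small` and 1 from Young's inequality; the contradictions
          -- below need it to be less than 2.
          κ : ℚ
          κ = + 172 ℚ./ 100

        -- Young's inequality 2LM′(u - v) ≤ L²(u - v)² + M′² avoids square roots. The squared
        -- difference is one term of the sum deg(x) E(x), hence at most 8dθM² with d the maximal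
        -- degree, and `θ-small` absorbs the factor L². `M′` may be any square root of M², so both
        -- signs are covered.
        step-bound : ∀ {x y} → x ∼ y → ∀ M′ → M′ * M′ ≈ M * M →
          ((fromℚ 2ℚ * nat L) * M′) * (f x - s * f y) ≤ fromℚ κ * (M * M)
        step-bound {x} {y} x∼y M′ e = ≤-trans young (≤-trans (+-mono-≤
            (*-monoʳ-≤ (0≤x*x P) bb≤) (≈⇒≤ e))
          (≤-trans (+-mono-≤ (≈⇒≤ (solve 4 (λ p d t m → (p :* p) :* (d :* (t :* m)) :=
                ((p :* p) :* (d :* t)) :* m) refl P d (fromℚ 8ℚ * θ) (M * M)))
              ≤-refl)
          (≤-trans (+-mono-≤ (*-monoˡ-≤ (0≤x*x M) θ-small) ≤-refl)
            (≈⇒≤ (solve 1 (λ m → con 72/100 :* m :+ m := con κ :* m) refl (M * M))))))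
          where
          P = nat L
          d = nat (maxDegree G)
          b = s * f y - f x
          young : ((fromℚ 2ℚ * P) * M′) * (f x - s * f y) ≤ (P * P) * (b * b) + M′ * M′
          young = 0≤⇒≤ (0≤x*x (P * b + M′)) (solve 4 (λ p m u v →
            ((p :* p) :* ((v :- u) :* (v :- u)) :+ m :* m) :- ((con 2ℚ :* p) :* m) :* (u :- v)
              := (p :* (v :- u) :+ m) :* (p :* (v :- u) :+ m)) refl P M′ (f x) (s * f y))
          bb≤ : b * b ≤ d * ((fromℚ 8ℚ * θ) * (M * M))
          bb≤ = ≤-trans (term≤degree*avg (λ z → (s * f z - f x) * (s * f z - f x))
                  (λ {z} _ → 0≤x*x (s * f z - f x)) x∼y)
                (≤-trans (*-monoˡ-≤ (0≤E x) (nat-mono-≤ (d≤ x)))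
                  (*-monoʳ-≤ (0≤nat (maxDegree G)) (E≤ max x)))

        infixr 8 s^_
        s^_ : ℕ → Carrier
        s^ zero  = fromℚ 1ℚ
        s^ suc k = s * s^ k

        -- Telescoping: f(x) - s^(k+1) f(z) = (f(x) - s f(y)) + s (f(y) - s^k f(z)). The factor `s`
        -- of the second part is absorbed into `M′`, which is why only the square of `M′` is
        -- prescribed.
        walk-bound : ∀ {x z k} → Walk G x z k → ∀ M′ → M′ * M′ ≈ M * M →
          ((fromℚ 2ℚ * nat L) * M′) * (f x - s^ k * f z) ≤ nat k * (fromℚ κ * (M * M))
        walk-bound {x} here M′ e = ≈⇒≤ (solve 4 (λ p m a c → ((con 2ℚ :* p) :* m) :* (a :- con 1ℚ :* a)
          := con 0ℚ :* c) refl (nat L) M′ (f x) (fromℚ κ * (M * M)))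
        walk-bound {x} {z} (step {y = y} {k = k} x∼y w) M′ e = ≤-trans
          (≈⇒≤ (solve 7 (λ q m s a b p c → (q :* m) :* (a :- (s :* p) :* c) :=
              (q :* m) :* (a :- s :* b) :+ (q :* (m :* s)) :* (b :- p :* c))
            refl (fromℚ 2ℚ * nat L) M′ s (f x) (f y) (s^ k) (f z)))
          (≤-trans (+-mono-≤ (step-bound x∼y M′ e) (walk-bound w (M′ * s) e′))
          (≤-trans (≈⇒≤ (solve 2 (λ c k → c :+ k :* c := (con 1ℚ :+ k) :* c) refl C (nat k)))
            (≈⇒≤ (*-cong (sym (nat-suc k)) refl))))
          where
          C = fromℚ κ * (M * M)
          e′ : (M′ * s) * (M′ * s) ≈ M * M
          e′ = trans (≈-mod-sign (M′ * M′) (solve 2 (λ m s → (m :* s) :* (m :* s) :=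
            m :* m :+ (s :* s :- con 1ℚ) :* (m :* m)) refl M′ s)) e

        s^k*s^k : ∀ k → s^ k * s^ k ≈ fromℚ 1ℚ
        s^k*s^k zero    = solve 1 (λ a → con 1ℚ :* con 1ℚ := con 1ℚ) refl s
        s^k*s^k (suc k) = trans (solve 2 (λ s p → (s :* p) :* (s :* p) := (s :* s) :* (p :* p)) refl s (s^ k))
          (trans (*-cong s*s≈1 (s^k*s^k k)) (solve 1 (λ a → con 1ℚ :* con 1ℚ := con 1ℚ) refl s))

        -- As `s * s` is 1, a power is `s` for odd exponents and 1 for even ones.
        s^-parity : ∀ j k → odd j ≡ odd k → s^ j ≈ s^ k
        s^-parity j k e = trans (normal j)
          (trans (≡.subst (λ b → sign (odd j) ≈ sign b) e refl) (sym (normal k)))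
          where
          sign : Bool → Carrier
          sign b = if b then s else fromℚ 1ℚ
          normal : ∀ k → s^ k ≈ sign (odd k)
          normal zero = refl
          normal (suc k) with odd k | normal k
          ... | false | e = trans (*-cong refl e) (solve 1 (λ s → s :* con 1ℚ := s) refl s)
          ... | true  | e = trans (*-cong refl e) s*s≈1

        module _ (0<L : ¬ (nat L ≤ 0#)) (0<M² : ¬ (M * M ≤ 0#)) where

          private
            C = fromℚ κ * (M * M)

            0≤C : 0# ≤ C
            0≤C = 0≤* (fromℚ-nonNeg (ℚ.nonNegative⁻¹ κ)) (0≤x*x M)

            absurd : ∀ q → 0ℚ ℚ.< q → ¬ (0# ≤ - (fromℚ q * (nat L * (M * M))))
            absurd q 0<q h = 0<* (fromℚ-pos 0<q) (0<* 0<L 0<M²) (0≤-x⇒x≤0 h)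

          -- If `M * f z` were at most 0, then 2LM(M - f(z)) would be at least 2LM², but
          -- `walk-bound` allows at most κLM². The constant 28/100 is 2 - κ.
          product-positive : s ≈ fromℚ 1ℚ → ∀ {z k} → Walk G x₀ z k → k ℕ.≤ L → ¬ (M * f z ≤ 0#)
          product-positive s≈1 {z} {k} w k≤L Mfz≤0 = absurd (+ 28 ℚ./ 100) (ℚ.positive⁻¹ _)
            (≤-respʳ-≈ eq (0≤+
              (x≤y⇒0≤y-x (≤-trans (walk-bound w M refl) (*-monoˡ-≤ 0≤C (nat-mono-≤ k≤L))))
              (0≤* (0≤* (fromℚ-nonNeg (ℚ.nonNegative⁻¹ 2ℚ)) (0≤nat L)) (x≤0⇒0≤-x Mfz≤0))))
            where
            s^k≈1 : ∀ k → s^ k ≈ fromℚ 1ℚ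
            s^k≈1 zero    = refl
            s^k≈1 (suc k) = trans (*-cong s≈1 (s^k≈1 k))
              (solve 1 (λ a → con 1ℚ :* con 1ℚ := con 1ℚ) refl s)
            eq = trans (+-cong (+-cong refl (-‿cong (*-cong refl (+-cong refl
                   (-‿cong (*-cong (s^k≈1 k) refl)))))) refl)
              (solve 3 (λ p m z → (p :* (con κ :* (m :* m)) :- ((con 2ℚ :* p) :* m) :* (m :- con 1ℚ :* z))
                  :+ (con 2ℚ :* p) :* (:- (m :* z)) := :- (con (+ 28 ℚ./ 100) :* (p :* (m :* m))))
                refl (nat L) M (f z))

          -- Adding the bounds for both walks and the edge, the values at `u` and `v` cancel and
          -- 4LM² ≤ κ(j + k + 1)M² remains. With j + k + 1 ≤ L this is absurd; 228/100 is 4 - κ.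
          no-odd-cycle : s ≈ - fromℚ 1ℚ → ∀ {u v j k} → Walk G x₀ u j → u ∼ v → Walk G x₀ v k →
            odd j ≡ odd k → j ℕ.+ suc k ℕ.≤ L → ⊥
          no-odd-cycle s≈-1 {u} {v} {j} {k} wu u∼v wv same j+1+k≤L = absurd (+ 228 ℚ./ 100) (ℚ.positive⁻¹ _)
            (≤-respʳ-≈ eq (x≤y⇒0≤y-x (≤-trans
              (+-mono-≤ (+-mono-≤ (walk-bound wu M refl) (walk-bound wv M refl))
                        -- For σ = s^j = s^k and s = -1 the edge contributes 2LMσ(f(u) + f(v)),
                        -- which cancels the end terms of the two walks.
                        (step-bound u∼v (M * s^ j) Mσ²))
              (≤-trans (≈⇒≤ count) (*-monoˡ-≤ 0≤C (nat-mono-≤ j+1+k≤L))))))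
            where
            Mσ² : (M * s^ j) * (M * s^ j) ≈ M * M
            Mσ² = trans (solve 2 (λ m p → (m :* p) :* (m :* p) := (m :* m) :* (p :* p)) refl M (s^ j))
              (trans (*-cong refl (s^k*s^k j)) (solve 1 (λ m → m :* con 1ℚ := m) refl (M * M)))
            count : nat j * C + nat k * C + C ≈ nat (j ℕ.+ suc k) * C
            count = trans (solve 3 (λ a b c → a :* c :+ b :* c :+ c := (a :+ (con 1ℚ :+ b)) :* c) refl
                (nat j) (nat k) C)
              (*-cong (trans (+-cong refl (sym (nat-suc k))) (sym (nat-+ j (suc k)))) refl)
            eq = trans (+-cong refl (-‿cong (+-cong
                   (+-cong refl (*-cong refl (+-cong refl (-‿cong (*-cong (s^-parity k j (≡.sym same)) refl)))))
                   (*-cong refl (+-cong refl (-‿cong (*-cong s≈-1 refl)))))))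
              (solve 5 (λ p m σ u v → p :* (con κ :* (m :* m)) :-
                  (((con 2ℚ :* p) :* m) :* (m :- σ :* u) :+ ((con 2ℚ :* p) :* m) :* (m :- σ :* v)
                    :+ ((con 2ℚ :* p) :* (m :* σ)) :* (u :- (:- con 1ℚ) :* v))
                  := :- (con (+ 228 ℚ./ 100) :* (p :* (m :* m))))
                refl (nat L) M (s^ j) (f u) (f v))

    -- At a minimum of `f x₀ * f z` over `z` the Laplacian of this function is nonnegative; it is
    -- also -μ times the value there, which is strictly positive.
    eigenvalue-nonPos : s ≈ fromℚ 1ℚ → ∀ x₀ → (∀ z → ¬ (f x₀ * f z ≤ 0#)) → μ ≤ 0#
    eigenvalue-nonPos s≈1 x₀ pos = ≤-stable λ μ≰0 → ¬¬argmax-inhabited (λ z → - (f x₀ * f z)) x₀ λ (x , max) →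
      μ≰0 (0≤-x⇒x≤0 (*-cancel-0≤ (pos x) (≤-respʳ-≈ (eq x) (Δ-max max))))
      where
      eq : ∀ x → - Δ (λ z → - (f x₀ * f z)) x ≈ (f x₀ * f x) * - μ
      eq x = begin
        - avg x (λ y → - (f x₀ * f y) - - (f x₀ * f x))
          ≈⟨ -‿cong (avg-cong x λ {y} _ → solve 3 (λ m a b → :- (m :* b) :- :- (m :* a) :=
               (:- m) :* (con 1ℚ :* b :- a)) refl (f x₀) (f x) (f y)) ⟩
        - avg x (λ y → - f x₀ * (fromℚ 1ℚ * f y - f x))
          ≈⟨ -‿cong (trans (avg-* x _ (- f x₀)) (*-cong refl
               (avg-cong x λ _ → +-cong (*-cong (sym s≈1) refl) refl))) ⟩
        - (- f x₀ * avg x (λ y → s * f y - f x))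
          ≈⟨ -‿cong (*-cong refl (eigen x)) ⟩
        - (- f x₀ * - (μ * f x))
          ≈⟨ solve 3 (λ m u a → :- ((:- m) :* (:- (u :* a))) := (m :* a) :* (:- u)) refl (f x₀) μ (f x) ⟩
        (f x₀ * f x) * - μ ∎

  ¬¬peak : Fin n → (f : Fin n → Carrier) → ¬ (∀ x → f x ≈ 0#) →
    ¬ ¬ (∃ λ x₀ → (∀ y → f y * f y ≤ f x₀ * f x₀) × ¬ (f x₀ * f x₀ ≤ 0#))
  ¬¬peak x f f≢0 k = ¬¬argmax-inhabited (λ y → f y * f y) x λ (x₀ , max) →
    k (x₀ , max , λ fx₀²≤0 → f≢0 λ y → x*x≤0⇒x≈0 (≤-trans (max y) fx₀²≤0))

  -- Bounds for a single eigenpair and for an eigenbasis.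

  module Bounds (cd : ∀ g x → 0# ≤ Γ₂ g g x) (triangle-free : TriangleFree G)
    (D : ℕ) (1≤D : 1 ℕ.≤ D) (distance : ∀ x y → ∃ λ k → Walk G x y k × k ℕ.≤ D)
    (θ : Carrier) (0<θ : ¬ (θ ≤ 0#)) (d≤ : ∀ x → degree G x ℕ.≤ maxDegree G)
    (θ-small : (nat (3 ℕ.* D) * nat (3 ℕ.* D)) * (nat (maxDegree G) * (fromℚ 8ℚ * θ))
               ≤ fromℚ 72/100) where

    0<3D : ¬ (nat (3 ℕ.* D) ≤ 0#)
    0<3D = 0<nat⁺ {3 ℕ.* D} (ℕ.≤-trans 1≤D (ℕ.m≤m+n D _))

    1*1≈1 : fromℚ 1ℚ * fromℚ 1ℚ ≈ fromℚ 1ℚ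
    1*1≈1 = solve 1 (λ a → con 1ℚ :* con 1ℚ := con 1ℚ) refl 0#

    -1*-1≈1 : - fromℚ 1ℚ * - fromℚ 1ℚ ≈ fromℚ 1ℚ
    -1*-1≈1 = solve 1 (λ a → (:- con 1ℚ) :* (:- con 1ℚ) := con 1ℚ) refl 0#

    -- The vertex `x` makes the vertex set inhabited, so that `¬¬peak` can be applied.
    module Eigenpair (μ : Carrier) (f : Fin n → Carrier) (f≢0 : ¬ (∀ x → f x ≈ 0#))
      (-Δf≈μf : ∀ x → - Δ f x ≈ μ * f x) (x : Fin n) where

      eigen⁺ : SignedEigen (fromℚ 1ℚ) μ f
      eigen⁺ x = begin
        avg x (λ y → fromℚ 1ℚ * f y - f x)
          ≈⟨ avg-cong x (λ {y} _ → solve 2 (λ a b → con 1ℚ :* b :- a := b :- a) refl (f x) (f y)) ⟩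
        Δ f x     ≈⟨ solve 1 (λ a → a := :- (:- a)) refl (Δ f x) ⟩
        - - Δ f x ≈⟨ -‿cong (-Δf≈μf x) ⟩
        - (μ * f x) ∎

      open Signed cd triangle-free (fromℚ 1ℚ) 1*1≈1 μ f eigen⁺

      0≤μ : 0# ≤ μ
      0≤μ = ≤-stable λ 0≰μ → ¬¬peak x f f≢0 λ (x₀ , max , fx₀≢0) → 0≰μ (eigenvalue-nonNeg max fx₀≢0)

      product-pos : μ ≤ θ → ∀ {x₀} → (∀ y → f y * f y ≤ f x₀ * f x₀) → ¬ (f x₀ * f x₀ ≤ 0#) →
        ∀ z → ¬ (f x₀ * f z ≤ 0#)
      product-pos μ≤θ {x₀} max fx₀≢0 z with k , w , k≤D ← distance x₀ z =
        Gradient.product-positive θ 0<θ μ≤θ x₀ max d≤ (3 ℕ.* D) θ-small 0<3D fx₀≢0 refl w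
          (ℕ.≤-trans k≤D (ℕ.m≤m+n D _))

      -- By `product-pos` such an `f` has constant sign, so `eigenvalue-nonPos` applies. With `0≤μ`
      -- this is a spectral gap above 0.
      μ≤θ⇒μ≤0 : μ ≤ θ → μ ≤ 0#
      μ≤θ⇒μ≤0 μ≤θ = ≤-stable λ μ≰0 → ¬¬peak x f f≢0 λ (x₀ , max , fx₀≢0) →
        μ≰0 (eigenvalue-nonPos refl x₀ (product-pos μ≤θ max fx₀≢0))

      μ≤θ⇒nowhere-zero : μ ≤ θ → ∀ z → ¬ (f z ≈ 0#)
      μ≤θ⇒nowhere-zero μ≤θ z fz≈0 = ¬¬peak x f f≢0 λ (x₀ , max , fx₀≢0) →
        product-pos μ≤θ max fx₀≢0 z (≈⇒≤ (trans (*-cong refl fz≈0) (zeroʳ (f x₀))))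

      module _ (neighbour : ∀ x → ∃ λ y → x ∼ y) where

        -- Rests on -f(y) - f(x) = -2f(x) - (f(y) - f(x)). The constant -2f(x) equals its own
        -- average because `x` has a neighbour.
        eigen⁻ : SignedEigen (- fromℚ 1ℚ) (fromℚ 2ℚ - μ) f
        eigen⁻ x = begin
          avg x (λ y → - fromℚ 1ℚ * f y - f x)
            ≈⟨ avg-cong x (λ {y} _ → solve 2 (λ a b → (:- con 1ℚ) :* b :- a :=
                 (:- con 2ℚ) :* a :+ (:- con 1ℚ) :* (b :- a)) refl (f x) (f y)) ⟩
          avg x (λ y → - fromℚ 2ℚ * f x + - fromℚ 1ℚ * (f y - f x))
            ≈⟨ avg-linear x (λ _ → - fromℚ 2ℚ * f x) (λ y → f y - f x) (- fromℚ 1ℚ) ⟩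
          avg x (λ _ → - fromℚ 2ℚ * f x) + - fromℚ 1ℚ * Δ f x
            ≈⟨ +-cong (avg-const (proj₂ (neighbour x)) _)
                 (trans (solve 1 (λ a → (:- con 1ℚ) :* a := :- a) refl (Δ f x)) (-Δf≈μf x)) ⟩
          - fromℚ 2ℚ * f x + μ * f x
            ≈⟨ solve 2 (λ m a → (:- con 2ℚ) :* a :+ m :* a := :- ((con 2ℚ :- m) :* a)) refl μ (f x) ⟩
          - ((fromℚ 2ℚ - μ) * f x) ∎

        -- Two adjacent vertices at distances of equal parity from x₀ close up an odd
        -- walk of length at most 2D + 1 ≤ 3D.
        μ≤2-θ : ¬ Bipartite G → μ ≤ fromℚ 2ℚ - θ
        μ≤2-θ ¬bip = 0≤⇒≤ (x≤y⇒0≤y-x (≰⇒≥ λ 2-μ≤θ → ¬¬peak x f f≢0 λ (x₀ , max , fx₀≢0) →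
            let dist = λ y → proj₁ (distance x₀ y)
                walk = λ y → proj₁ (proj₂ (distance x₀ y))
                ≤D   = λ y → proj₂ (proj₂ (distance x₀ y))
            in ¬bip ((λ y → odd (dist y)) , λ u v u∼v same →
              Signed.Gradient.no-odd-cycle cd triangle-free (- fromℚ 1ℚ) -1*-1≈1 (fromℚ 2ℚ - μ) f eigen⁻
                θ 0<θ 2-μ≤θ x₀ max d≤ (3 ℕ.* D) θ-small 0<3D fx₀≢0 refl (walk u) u∼v (walk v) same
                (ℕ.+-mono-≤ (≤D u) (ℕ.≤-trans (ℕ.+-mono-≤ 1≤D (≤D v))
                  (ℕ.≤-reflexive (cong (D ℕ.+_) (≡.sym (ℕ.+-identityʳ D)))))))))
          (solve 2 (λ m t → (con 2ℚ :- t) :- m := (con 2ℚ :- m) :- t) refl μ θ)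

    Δ-∑ : ∀ {I : Set} (is : List I) (a : I → Carrier) (φ : I → Fin n → Carrier) x →
      Δ (λ y → ∑ is (λ i → a i * φ i y)) x ≈ ∑ is (λ i → a i * Δ (φ i) x)
    Δ-∑ []       a φ x = begin
      avg x (λ _ → 0# - 0#)        ≈⟨ avg-cong x (λ _ → trans (-‿inverseʳ 0#) (sym (zeroˡ 0#))) ⟩
      avg x (λ _ → 0# * 0#)        ≈⟨ avg-* x (λ _ → 0#) 0# ⟩
      0# * avg x (λ _ → 0#)        ≈⟨ zeroˡ _ ⟩
      0#                           ∎
    Δ-∑ (i ∷ is) a φ x = begin
      avg x (λ y → (a i * φ i y + S y) - (a i * φ i x + S x))
        ≈⟨ avg-cong x (λ {y} _ → solve 5 (λ a p q u v → (a :* p :+ u) :- (a :* q :+ v) :=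
             (u :- v) :+ a :* (p :- q)) refl (a i) (φ i y) (φ i x) (S y) (S x)) ⟩
      avg x (λ y → (S y - S x) + a i * (φ i y - φ i x))
        ≈⟨ avg-linear x (λ y → S y - S x) (λ y → φ i y - φ i x) (a i) ⟩
      Δ S x + a i * Δ (φ i) x
        ≈⟨ +-cong (Δ-∑ is a φ x) refl ⟩
      ∑ is (λ j → a j * Δ (φ j) x) + a i * Δ (φ i) x
        ≈⟨ solve 2 (λ a b → a :+ b := b :+ a) refl _ (a i * Δ (φ i) x) ⟩
      a i * Δ (φ i) x + ∑ is (λ j → a j * Δ (φ j) x) ∎
      where
      S : Fin n → Carrier
      S y = ∑ is (λ j → a j * φ j y)

    module Basis (φ : Fin n → Fin n → Carrier) (ev : Fin n → Carrier)
      (φ≢0 : ∀ i → ¬ (∀ x → φ i x ≈ 0#))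
      (-Δφ≈evφ : ∀ i x → - Δ (φ i) x ≈ ev i * φ i x)
      (independent : ∀ (a : Fin n → Carrier) →
        (∀ x → ∑ (allFin n) (λ i → a i * φ i x) ≈ 0#) → ∀ i → a i ≈ 0#)
      (spanning : ∀ (f : Fin n → Carrier) →
        ∃ λ (a : Fin n → Carrier) → ∀ x → f x ≈ ∑ (allFin n) (λ i → a i * φ i x)) where

      -- Expand the constant 1 in the basis and apply Δ: every coefficient vanishes
      -- if all eigenvalues are positive.
      ¬all-positive : Fin n → ¬ (∀ i → ¬ (ev i ≤ 0#))
      ¬all-positive x 0<ev = fromℚ-pos (ℚ.positive⁻¹ 1ℚ) (≈⇒≤ (begin
        fromℚ 1ℚ                            ≈⟨ 1≈ x ⟩
        ∑ (allFin n) (λ i → a i * φ i x)    ≈⟨ ∑-zero (allFin n) (λ {i} _ →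
                                                 trans (*-cong (a≈0 i) refl) (zeroˡ (φ i x))) ⟩
        0#                                  ∎))
        where
        a = proj₁ (spanning (λ _ → fromℚ 1ℚ))
        1≈ = proj₂ (spanning (λ _ → fromℚ 1ℚ))
        ∑≈0 : ∀ x → ∑ (allFin n) (λ i → - (a i * ev i) * φ i x) ≈ 0#
        ∑≈0 x = begin
          ∑ (allFin n) (λ i → - (a i * ev i) * φ i x)
            ≈⟨ ∑-cong (allFin n) (λ {i} _ → trans
                 (solve 3 (λ a e p → (:- (a :* e)) :* p := :- (a :* (e :* p))) refl (a i) (ev i) (φ i x))
                 (trans (-‿cong (*-cong refl (sym (-Δφ≈evφ i x))))
                   (solve 2 (λ a d → :- (a :* (:- d)) := a :* d) refl (a i) (Δ (φ i) x)))) ⟩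
          ∑ (allFin n) (λ i → a i * Δ (φ i) x)
            ≈⟨ Δ-∑ (allFin n) a φ x ⟨
          Δ (λ y → ∑ (allFin n) (λ i → a i * φ i y)) x
            ≈⟨ avg-cong x (λ {y} _ → trans (+-cong (sym (1≈ y)) (-‿cong (sym (1≈ x))))
                 (solve 1 (λ a → con 1ℚ :- con 1ℚ := con 0ℚ :* a) refl 0#)) ⟩
          avg x (λ _ → fromℚ 0ℚ * 0#)
            ≈⟨ avg-* x (λ _ → 0#) (fromℚ 0ℚ) ⟩
          fromℚ 0ℚ * avg x (λ _ → 0#)
            ≈⟨ trans (*-cong 0-homo refl) (zeroˡ _) ⟩
          0# ∎
        a≈0 : ∀ i → a i ≈ 0#
        a≈0 i = *-cancel-≈0 (0<ev i) (trans
          (solve 2 (λ a e → e :* a := (:- con 1ℚ) :* (:- (a :* e))) refl (a i) (ev i))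
          (trans (*-cong refl (independent _ ∑≈0 i)) (zeroʳ _)))

      module Pair (i : Fin n) = Eigenpair (ev i) (φ i) (φ≢0 i) (-Δφ≈evφ i)

      -- Were the lowest eigenvalue positive, all of them would be, against `¬all-positive`; and
      -- every eigenvalue is nonnegative.
      lowest≈0 : ∀ i₀ → (∀ i → ev i₀ ≤ ev i) → ev i₀ ≈ 0#
      lowest≈0 i₀ lowest = ≤-antisym
        (≤-stable λ ev≰0 → ¬all-positive i₀ λ i evi≤0 → ev≰0 (≤-trans (lowest i) evi≤0))
        (Pair.0≤μ i₀ i₀)

      -- The combination of φ i and φ j vanishing at x is harmonic, and a nonzero
      -- harmonic function vanishes nowhere.
      small⇒proportional : ∀ {i j} → ev i ≤ θ → ev j ≤ θ →
        ∀ x y → φ j x * φ i y + - φ i x * φ j y ≈ 0#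
      small⇒proportional {i} {j} evi≤θ evj≤θ x y = ≈-stable λ gy≉0 →
        Eigenpair.μ≤θ⇒nowhere-zero 0# g (λ g≈0 → gy≉0 (g≈0 y)) harmonic x (≰⇒≥ 0<θ) x
          (trans (solve 2 (λ a b → b :* a :+ (:- a) :* b := a :* b :- a :* b) refl (φ i x) (φ j x))
            (-‿inverseʳ _))
        where
        p = φ j x
        q = - φ i x
        g : Fin n → Carrier
        g y = p * φ i y + q * φ j y
        ev≈0 : ∀ {k} → ev k ≤ θ → ev k ≈ 0#
        ev≈0 {k} evk≤θ = ≤-antisym (Pair.μ≤θ⇒μ≤0 k x evk≤θ) (Pair.0≤μ k x)
        Δφ≈0 : ∀ {k} → ev k ≤ θ → ∀ z → Δ (φ k) z ≈ 0#
        Δφ≈0 {k} evk≤θ z = begin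
          Δ (φ k) z        ≈⟨ solve 1 (λ a → a := (:- con 1ℚ) :* (:- a)) refl (Δ (φ k) z) ⟩
          - fromℚ 1ℚ * - Δ (φ k) z ≈⟨ *-cong refl (trans (-Δφ≈evφ k z)
                                        (trans (*-cong (ev≈0 evk≤θ) refl) (zeroˡ _))) ⟩
          - fromℚ 1ℚ * 0#  ≈⟨ zeroʳ _ ⟩
          0#               ∎
        harmonic : ∀ z → - Δ g z ≈ 0# * g z
        harmonic z = begin
          - Δ g z
            ≈⟨ -‿cong (avg-cong z λ {y} _ → solve 6 (λ p q a b c d →
                 (p :* a :+ q :* b) :- (p :* c :+ q :* d) := p :* (a :- c) :+ q :* (b :- d))
                 refl p q (φ i y) (φ j y) (φ i z) (φ j z)) ⟩
          - avg z (λ y → p * (φ i y - φ i z) + q * (φ j y - φ j z))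
            ≈⟨ -‿cong (trans (avg-linear z (λ y → p * (φ i y - φ i z)) (λ y → φ j y - φ j z) q)
                 (+-cong (avg-* z _ p) refl)) ⟩
          - (p * Δ (φ i) z + q * Δ (φ j) z)
            ≈⟨ -‿cong (+-cong (*-cong refl (Δφ≈0 evi≤θ z)) (*-cong refl (Δφ≈0 evj≤θ z))) ⟩
          - (p * 0# + q * 0#)
            ≈⟨ solve 4 (λ p q o g → :- (p :* o :+ q :* o) := o :* (:- p :- q)) refl p q 0# 0# ⟩
          0# * (- p - q)
            ≈⟨ trans (zeroˡ _) (sym (zeroˡ _)) ⟩
          0# * g z ∎

-- The spectrum of a graph with at least two vertices.

module TwoVertices (K : StableOrderedRing) {m : ℕ} (G : Graph (suc (suc m))) where

  open OrderedRingProperties K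
  open Sol using (solve; con; _:+_; _:*_; _:-_; :-_; _:=_)
  open GraphAnalysis K G
  open import Relation.Binary.Reasoning.Setoid setoid

  module Spectrum (cd : ∀ g x → 0# ≤ Γ₂ g g x) (triangle-free : TriangleFree G) (¬bipartite : ¬ Bipartite G)
    (D : ℕ) (1≤D : 1 ℕ.≤ D) (distance : ∀ x y → ∃ λ k → Walk G x y k × k ℕ.≤ D)
    (neighbour : ∀ x → ∃ λ y → Graph._∼_ G x y)
    (ev : Fin (suc (suc m)) → Carrier) (ev-mono : ∀ i j → i Fin.≤ j → ev i ≤ ev j)
    (φ : Fin (suc (suc m)) → Fin (suc (suc m)) → Carrier)
    (eigen : ∀ i → ¬ (∀ x → φ i x ≈ 0#) × (∀ x → - Δ (φ i) x ≈ ev i * φ i x))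
    (independent : ∀ (a : Fin (suc (suc m)) → Carrier) →
      (∀ x → ∑ (allFin (suc (suc m))) (λ i → a i * φ i x) ≈ 0#) → ∀ i → a i ≈ 0#)
    (spanning : ∀ (f : Fin (suc (suc m)) → Carrier) →
      ∃ λ (a : Fin (suc (suc m)) → Carrier) → ∀ x → f x ≈ ∑ (allFin (suc (suc m))) (λ i → a i * φ i x)) where

    -- Ensures that `θ` is a genuine quotient and not the default value 0.
    1≤maxDegree*D² : 1 ℕ.≤ maxDegree G ℕ.* D ^ 2
    1≤maxDegree*D² = ℕ.*-mono-≤
      (ℕ.≤-trans (∈-length (∈-neighbours⁺ (proj₂ (neighbour zero)))) (degree≤maxDegree G zero))
      (ℕ.^-monoˡ-≤ 2 1≤D)

    θ : Carrier
    θ = fromℚ 1/100 ÷ (maxDegree G ℕ.* D ^ 2)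

    open Bounds cd triangle-free D 1≤D distance θ
      (fromℚ÷-pos (ℚ.positive⁻¹ 1/100) 1≤maxDegree*D²) (degree≤maxDegree G)
      (1/100÷-small (maxDegree G) D 1≤maxDegree*D²)
    open Basis φ ev (proj₁ ∘ eigen) (proj₂ ∘ eigen) independent spanning

    first≈0 : ev zero ≈ 0#
    first≈0 = lowest≈0 zero (λ i → ev-mono zero i z≤n)

    last≤2-θ : ev (opposite zero) ≤ fromℚ 2ℚ - θ
    last≤2-θ = Pair.μ≤2-θ (opposite zero) zero neighbour ¬bipartite

    -- If the second eigenvalue were at most `θ`, so would be the first. The combination of their
    -- eigenfunctions vanishing at vertex `zero` would then vanish everywhere, and independence
    -- would make its coefficient `- φ zero zero` equal to 0, whereas an eigenfunction with
    -- eigenvalue at most `θ` has no zero.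
    θ≤second : θ ≤ ev (suc zero)
    θ≤second = ≰⇒≥ λ ev₂≤θ →
      let ev₁≤θ = ≤-trans (ev-mono zero (suc zero) z≤n) ev₂≤θ in
      Pair.μ≤θ⇒nowhere-zero zero zero ev₁≤θ zero (begin
        φ zero zero                ≈⟨ solve 1 (λ a → a := (:- con 1ℚ) :* (:- a)) refl (φ zero zero) ⟩
        - fromℚ 1ℚ * - φ zero zero ≈⟨ *-cong refl (independent a
          (λ y → trans (∑≈ y) (small⇒proportional ev₁≤θ ev₂≤θ zero y)) (suc zero)) ⟩
        - fromℚ 1ℚ * 0#            ≈⟨ zeroʳ _ ⟩
        0#                         ∎)
      where
      a : Fin (suc (suc m)) → Carrier
      a zero          = φ (suc zero) zero
      a (suc zero)    = - φ zero zero
      a (suc (suc _)) = 0#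
      rest : List (Fin (suc (suc m)))
      rest = List.tabulate (λ i → suc (suc i))
      term≈0 : ∀ y {k} → k ∈ rest → a k * φ k y ≈ 0#
      term≈0 y k∈ with ∈-tabulate⁻ k∈
      ... | _ , ≡.refl = zeroˡ _
      ∑≈ : ∀ y → ∑ (allFin (suc (suc m))) (λ i → a i * φ i y)
               ≈ φ (suc zero) zero * φ zero y + - φ zero zero * φ (suc zero) y
      ∑≈ y = +-cong refl (trans (+-cong refl (∑-zero rest (term≈0 y))) (+-identityʳ _))

  module _ (∑ᴳ : List (Fin (suc (suc m))) → (Fin (suc (suc m)) → Carrier) → Carrier)
    (_⊕_ _·_ _⊖_ : Carrier → Carrier → Carrier) (neg : Carrier → Carrier) (_⊘_ : Carrier → ℕ → Carrier)
    (rat : ℚ → Carrier) (Δᴳ : (Fin (suc (suc m)) → Carrier) → Fin (suc (suc m)) → Carrier)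
    (Γᴳ Γ₂ᴳ : (f g : Fin (suc (suc m)) → Carrier) → Fin (suc (suc m)) → Carrier)
    (∑-def : ∀ xs f → ∑ᴳ xs f ≈ foldr (λ a r → f a ⊕ r) (rat 0ℚ) xs)
    (⊕≈+ : ∀ x y → x ⊕ y ≈ x + y) (·≈* : ∀ x y → x · y ≈ x * y) (neg≈- : ∀ x → neg x ≈ - x)
    (rat≈fromℚ : ∀ q → rat q ≈ fromℚ q) (⊖-def : ∀ x y → x ⊖ y ≈ x ⊕ neg y)
    (⊘-zero : ∀ x → x ⊘ 0 ≈ rat 0ℚ) (⊘-suc : ∀ x k → x ⊘ suc k ≈ rat (+ 1 ℚ./ suc k) · x)
    (Δ-def : ∀ f x → Δᴳ f x ≈ ∑ᴳ (neighbours G x) (λ y → f y ⊖ f x) ⊘ degree G x)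
    (Γ-def : ∀ f g x → Γᴳ f g x ≈ ((Δᴳ (λ y → f y · g y) x ⊖ (g x · Δᴳ f x)) ⊖ (f x · Δᴳ g x)) ⊘ 2)
    (Γ₂-def : ∀ f g x → Γ₂ᴳ f g x ≈ ((Δᴳ (Γᴳ f g) x ⊖ Γᴳ g (Δᴳ f) x) ⊖ Γᴳ f (Δᴳ g) x) ⊘ 2) where

    open Agreement ∑ᴳ _⊕_ _·_ _⊖_ neg _⊘_ rat Δᴳ Γᴳ Γ₂ᴳ ∑-def ⊕≈+ ·≈* neg≈-
      rat≈fromℚ ⊖-def ⊘-zero ⊘-suc Δ-def Γ-def Γ₂-def

    bounds : TriangleFree G → ¬ Bipartite G → (∀ g x → 0# ≤ Γ₂ᴳ g g x) →
      ∀ D → 1 ℕ.≤ D → (∀ x y → ∃ λ k → Walk G x y k × k ℕ.≤ D) → (∀ x → ∃ λ y → Graph._∼_ G x y) →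
      ∀ (ev : Fin (suc (suc m)) → Carrier) → (∀ i j → i Fin.≤ j → ev i ≤ ev j) →
      ∀ (φ : Fin (suc (suc m)) → Fin (suc (suc m)) → Carrier) →
      (∀ i → ¬ (∀ x → φ i x ≈ 0#) × (∀ x → neg (Δᴳ (φ i) x) ≈ (ev i · φ i x))) →
      (∀ (a : Fin (suc (suc m)) → Carrier) →
        (∀ x → ∑ᴳ (allFin (suc (suc m))) (λ i → a i · φ i x) ≈ 0#) → ∀ i → a i ≈ 0#) →
      (∀ (f : Fin (suc (suc m)) → Carrier) →
        ∃ λ (a : Fin (suc (suc m)) → Carrier) → ∀ x → f x ≈ ∑ᴳ (allFin (suc (suc m))) (λ i → a i · φ i x)) →
      ev zero ≈ 0# × (1 ℕ.≤ maxDegree G ℕ.* D ^ 2) × (rat 1/100 ⊘ (maxDegree G ℕ.* D ^ 2) ≤ ev (suc zero)) ×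
      (ev (opposite zero) ≤ rat 2ℚ ⊖ (rat 1/100 ⊘ (maxDegree G ℕ.* D ^ 2)))
    bounds triangle-free ¬bip cd D 1≤D distance neighbour ev ev-mono φ eigen independent spanning =
      first≈0 , 1≤maxDegree*D² , ≤-respˡ-≈ (sym θ≈) θ≤second ,
      ≤-respʳ-≈ (sym (⊖-cong (rat≈fromℚ 2ℚ) θ≈)) last≤2-θ
      where
      combination≈ : ∀ a x → ∑ᴳ (allFin (suc (suc m))) (λ i → a i · φ i x) ≈
        ∑ (allFin (suc (suc m))) (λ i → a i * φ i x)
      combination≈ a x = ∑ᴳ≈∑ (allFin (suc (suc m))) (λ i → ·≈* (a i) (φ i x))
      cd′ : ∀ g x → 0# ≤ Γ₂ g g x
      cd′ g x = ≤-respʳ-≈ (Γ₂ᴳ≈Γ₂ g g x) (cd g x)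
      eigen′ : ∀ i → ¬ (∀ x → φ i x ≈ 0#) × (∀ x → - Δ (φ i) x ≈ ev i * φ i x)
      eigen′ i = proj₁ (eigen i) , λ x → trans (-‿cong (sym (Δᴳ≈Δ (λ _ → refl) x)))
        (trans (sym (neg≈- _)) (trans (proj₂ (eigen i) x) (·≈* _ _)))
      independent′ : ∀ (a : Fin (suc (suc m)) → Carrier) →
        (∀ x → ∑ (allFin (suc (suc m))) (λ i → a i * φ i x) ≈ 0#) → ∀ i → a i ≈ 0#
      independent′ a h = independent a (λ x → trans (combination≈ a x) (h x))
      spanning′ : ∀ (f : Fin (suc (suc m)) → Carrier) →
        ∃ λ (a : Fin (suc (suc m)) → Carrier) → ∀ x → f x ≈ ∑ (allFin (suc (suc m))) (λ i → a i * φ i x)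
      spanning′ f = proj₁ (spanning f) , λ x → trans (proj₂ (spanning f) x) (combination≈ _ x)
      open Spectrum cd′ triangle-free ¬bip D 1≤D distance neighbour ev ev-mono φ
        eigen′ independent′ spanning′
      θ≈ : rat 1/100 ⊘ (maxDegree G ℕ.* D ^ 2) ≈ θ
      θ≈ = ⊘-cong (maxDegree G ℕ.* D ^ 2) (rat≈fromℚ 1/100)

-- Rational numbers

open import Defs
open ≡ using (refl)

infix 4 _≈_ _≼_

private
  module Q = +-*-Solver

p≤∣p∣ : ∀ p → p ℚ.≤ ∣ p ∣
p≤∣p∣ p with ℚ.≤-total 0ℚ p
... | inj₁ 0≤p = ℚ.≤-reflexive (≡.sym (ℚ.0≤p⇒∣p∣≡p 0≤p))
... | inj₂ p≤0 = ℚ.≤-trans p≤0 (ℚ.0≤∣p∣ p)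

∣p∣≤r : ∀ p {r} → p ℚ.≤ r → ℚ.- p ℚ.≤ r → ∣ p ∣ ℚ.≤ r
∣p∣≤r p p≤r -p≤r with ℚ.∣p∣≡p∨∣p∣≡-p p
... | inj₁ e = subst (ℚ._≤ _) (≡.sym e) p≤r
... | inj₂ e = subst (ℚ._≤ _) (≡.sym e) -p≤r

0≤*ℚ : ∀ {p q} → 0ℚ ℚ.≤ p → 0ℚ ℚ.≤ q → 0ℚ ℚ.≤ p ℚ.* q
0≤*ℚ {p} {q} 0≤p 0≤q = ℚ.nonNegative⁻¹ _
  {{ℚ.nonNeg*nonNeg⇒nonNeg p {{ℚ.nonNegative 0≤p}} q {{ℚ.nonNegative 0≤q}}}}

0<*ℚ : ∀ {p q} → 0ℚ ℚ.< p → 0ℚ ℚ.< q → 0ℚ ℚ.< p ℚ.* q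
0<*ℚ {p} {q} 0<p 0<q = ℚ.positive⁻¹ _
  {{ℚ.pos*pos⇒pos p {{ℚ.positive 0<p}} q {{ℚ.positive 0<q}}}}

0<½*ℚ : ∀ {ε} → 0ℚ ℚ.< ε → 0ℚ ℚ.< ½ ℚ.* ε
0<½*ℚ = 0<*ℚ (ℚ.positive⁻¹ ½)

p≤q⇒0≤q-p : ∀ {p q} → p ℚ.≤ q → 0ℚ ℚ.≤ q ℚ.- p
p≤q⇒0≤q-p {p} {q} p≤q = subst (ℚ._≤ q ℚ.- p) (ℚ.+-inverseʳ p) (ℚ.+-monoˡ-≤ (ℚ.- p) p≤q)

0≤q-p⇒p≤q : ∀ {p q} → 0ℚ ℚ.≤ q ℚ.- p → p ℚ.≤ q
0≤q-p⇒p≤q {p} {q} h = ≡.subst₂ ℚ._≤_ (ℚ.+-identityˡ p)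
  (Q.solve 2 (λ p q → (q Q.:- p) Q.:+ p Q.:= q) refl p q) (ℚ.+-monoˡ-≤ p h)

≤-byℚ : ∀ {p q} r → 0ℚ ℚ.≤ r → q ℚ.- p ≡ r → p ℚ.≤ q
≤-byℚ r 0≤r e = 0≤q-p⇒p≤q (subst (0ℚ ℚ.≤_) (≡.sym e) 0≤r)

0≤+ℚ : ∀ {p q} → 0ℚ ℚ.≤ p → 0ℚ ℚ.≤ q → 0ℚ ℚ.≤ p ℚ.+ q
0≤+ℚ {p} {q} a b = subst (ℚ._≤ p ℚ.+ q) (ℚ.+-identityˡ 0ℚ) (ℚ.+-mono-≤ a b)

divide : ∀ {ε M} → 0ℚ ℚ.< ε → 0ℚ ℚ.< M → ∃ λ δ → 0ℚ ℚ.< δ × δ ℚ.* M ≡ ε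
divide {ε} {M} 0<ε 0<M = ε ℚ.* 1/ M ,
  0<*ℚ 0<ε (ℚ.positive⁻¹ _ {{ℚ.1/pos⇒pos M}}) ,
  ≡.trans (ℚ.*-assoc ε (1/ M) M) (≡.trans (cong (ε ℚ.*_) (ℚ.*-inverseˡ M)) (ℚ.*-identityʳ ε))
  where
  instance
    M>0 = ℚ.positive 0<M
    M≢0 = ℚ.pos⇒nonZero M

-- Factors of equal sign have a nonnegative product. If 0 ≤ X ≤ A and -δ ≤ Y, the product is at
-- least -δA, which ε = δ(A + B) absorbs; the other mixed case is symmetric.
0≤*-approx : ∀ X Y A B δ ε → 0ℚ ℚ.< ε → 0ℚ ℚ.< δ → 0ℚ ℚ.< A → 0ℚ ℚ.< B →
  δ ℚ.* (A ℚ.+ B) ≡ ε → 0ℚ ℚ.≤ X ℚ.+ δ → 0ℚ ℚ.≤ Y ℚ.+ δ → X ℚ.≤ A → Y ℚ.≤ B →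
  0ℚ ℚ.≤ X ℚ.* Y ℚ.+ ε
0≤*-approx X Y A B δ ε 0<ε 0<δ 0<A 0<B δ[A+B]≡ε X≥ Y≥ X≤ Y≤ =
  go (ℚ.≤-total 0ℚ X) (ℚ.≤-total 0ℚ Y)
  where
  0≤δ = ℚ.<⇒≤ 0<δ
  go : 0ℚ ℚ.≤ X ⊎ X ℚ.≤ 0ℚ → 0ℚ ℚ.≤ Y ⊎ Y ℚ.≤ 0ℚ → 0ℚ ℚ.≤ X ℚ.* Y ℚ.+ ε
  go (inj₁ 0≤X) (inj₁ 0≤Y) = 0≤+ℚ (0≤*ℚ 0≤X 0≤Y) (ℚ.<⇒≤ 0<ε)
  go (inj₂ X≤0) (inj₂ Y≤0) = 0≤+ℚ
    (subst (0ℚ ℚ.≤_) (Q.solve 2 (λ X Y → (Q.con 0ℚ Q.:- X) Q.:* (Q.con 0ℚ Q.:- Y) Q.:= X Q.:* Y)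
      refl X Y) (0≤*ℚ (p≤q⇒0≤q-p X≤0) (p≤q⇒0≤q-p Y≤0))) (ℚ.<⇒≤ 0<ε)
  go (inj₁ 0≤X) (inj₂ _) = subst (0ℚ ℚ.≤_)
    (≡.trans (Q.solve 5 (λ X Y A B d → (X Q.:* (Y Q.:+ d) Q.:+ d Q.:* (A Q.:- X)) Q.:+ d Q.:* B
        Q.:= X Q.:* Y Q.:+ d Q.:* (A Q.:+ B)) refl X Y A B δ) (cong (X ℚ.* Y ℚ.+_) δ[A+B]≡ε))
    (0≤+ℚ (0≤+ℚ (0≤*ℚ 0≤X Y≥) (0≤*ℚ 0≤δ (p≤q⇒0≤q-p X≤))) (0≤*ℚ 0≤δ (ℚ.<⇒≤ 0<B)))
  go (inj₂ _) (inj₁ 0≤Y) = subst (0ℚ ℚ.≤_)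
    (≡.trans (Q.solve 5 (λ X Y A B d → (Y Q.:* (X Q.:+ d) Q.:+ d Q.:* (B Q.:- Y)) Q.:+ d Q.:* A
        Q.:= X Q.:* Y Q.:+ d Q.:* (A Q.:+ B)) refl X Y A B δ) (cong (X ℚ.* Y ℚ.+_) δ[A+B]≡ε))
    (0≤+ℚ (0≤+ℚ (0≤*ℚ 0≤Y X≥) (0≤*ℚ 0≤δ (p≤q⇒0≤q-p Y≤))) (0≤*ℚ 0≤δ (ℚ.<⇒≤ 0<A)))

-- The ordered ring of real numbers

≤-pointwise : ∀ {x y} → (∀ n → seq x n ℚ.≤ seq y n) → x ≤ y
≤-pointwise {x} {y} h ε 0<ε = 0 , λ n _ → ℚ.≤-trans (h n)
  (≤-byℚ ε (ℚ.<⇒≤ 0<ε) (Q.solve 2 (λ y e → (y Q.:+ e) Q.:- y Q.:= e) refl (seq y n) ε))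

≤-trans : ∀ {x y z} → x ≤ y → y ≤ z → x ≤ z
≤-trans {x} {y} {z} h k ε 0<ε with h _ (0<½*ℚ 0<ε) | k _ (0<½*ℚ 0<ε)
... | M , h′ | N , k′ = M ⊔ N , λ n p → ≤-byℚ _
  (0≤+ℚ (p≤q⇒0≤q-p (h′ n (ℕ.m⊔n≤o⇒m≤o M N p))) (p≤q⇒0≤q-p (k′ n (ℕ.m⊔n≤o⇒n≤o M N p))))
  (Q.solve 4 (λ x y z e → (z Q.:+ e) Q.:- x Q.:=
      (y Q.:+ Q.con ½ Q.:* e Q.:- x) Q.:+ (z Q.:+ Q.con ½ Q.:* e Q.:- y))
    refl (seq x n) (seq y n) (seq z n) ε)

≃⇒≤ : ∀ {x y} → x ≃ y → x ≤ y
≃⇒≤ {x} {y} h ε 0<ε with h ε 0<ε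
... | N , h′ = N , λ n p → ≤-byℚ _
  (p≤q⇒0≤q-p (ℚ.≤-trans (p≤∣p∣ (seq x n ℚ.- seq y n)) (h′ n p)))
  (Q.solve 3 (λ x y e → (y Q.:+ e) Q.:- x Q.:= e Q.:- (x Q.:- y)) refl (seq x n) (seq y n) ε)

≤-antisym : ∀ {x y} → x ≤ y → y ≤ x → x ≃ y
≤-antisym {x} {y} h k ε 0<ε with h ε 0<ε | k ε 0<ε
... | M , h′ | N , k′ = M ⊔ N , λ n p → ∣p∣≤r (seq x n ℚ.- seq y n)
  (≤-byℚ _ (p≤q⇒0≤q-p (h′ n (ℕ.m⊔n≤o⇒m≤o M N p)))
    (Q.solve 3 (λ x y e → e Q.:- (x Q.:- y) Q.:= (y Q.:+ e) Q.:- x) refl (seq x n) (seq y n) ε))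
  (≤-byℚ _ (p≤q⇒0≤q-p (k′ n (ℕ.m⊔n≤o⇒n≤o M N p)))
    (Q.solve 3 (λ x y e → e Q.:- (Q.:- (x Q.:- y)) Q.:= (x Q.:+ e) Q.:- y)
      refl (seq x n) (seq y n) ε))

≃-pointwise : ∀ {x y} → (∀ n → seq x n ≡ seq y n) → x ≃ y
≃-pointwise {x} {y} h = ≤-antisym {x} {y} (≤-pointwise {x} {y} (ℚ.≤-reflexive ∘ h))
  (≤-pointwise {y} {x} (ℚ.≤-reflexive ∘ ≡.sym ∘ h))

≃-refl : ∀ {x} → x ≃ x
≃-refl {x} = ≃-pointwise {x} {x} (λ _ → refl)

≃-sym : ∀ {x y} → x ≃ y → y ≃ x
≃-sym {x} {y} h ε 0<ε with h ε 0<ε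
... | N , h′ = N , λ n p → subst (ℚ._≤ ε) (≡.trans (≡.sym (ℚ.∣-p∣≡∣p∣ (seq x n ℚ.- seq y n)))
  (cong ∣_∣ (Q.solve 2 (λ x y → Q.:- (x Q.:- y) Q.:= y Q.:- x) refl (seq x n) (seq y n)))) (h′ n p)

≃⇒≥ : ∀ {x y} → x ≃ y → y ≤ x
≃⇒≥ {x} {y} h = ≃⇒≤ {y} {x} (≃-sym {x} {y} h)

≃-trans : ∀ {x y z} → x ≃ y → y ≃ z → x ≃ z
≃-trans {x} {y} {z} h k = ≤-antisym {x} {z}
  (≤-trans {x} {y} {z} (≃⇒≤ {x} {y} h) (≃⇒≤ {y} {z} k))
  (≤-trans {z} {y} {x} (≃⇒≥ {y} {z} k) (≃⇒≥ {x} {y} h))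

+-mono-≤ : ∀ {x y u v} → x ≤ y → u ≤ v → x + u ≤ y + v
+-mono-≤ {x} {y} {u} {v} h k ε 0<ε with h _ (0<½*ℚ 0<ε) | k _ (0<½*ℚ 0<ε)
... | M , h′ | N , k′ = M ⊔ N , λ n p → ≤-byℚ _
  (0≤+ℚ (p≤q⇒0≤q-p (h′ n (ℕ.m⊔n≤o⇒m≤o M N p))) (p≤q⇒0≤q-p (k′ n (ℕ.m⊔n≤o⇒n≤o M N p))))
  (Q.solve 5 (λ x y u v e → ((y Q.:+ v) Q.:+ e) Q.:- (x Q.:+ u) Q.:=
      (y Q.:+ Q.con ½ Q.:* e Q.:- x) Q.:+ (v Q.:+ Q.con ½ Q.:* e Q.:- u))
    refl (seq x n) (seq y n) (seq u n) (seq v n) ε)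

neg-mono-≤ : ∀ {x y} → x ≤ y → - y ≤ - x
neg-mono-≤ {x} {y} h ε 0<ε with h ε 0<ε
... | N , h′ = N , λ n p → ≤-byℚ _ (p≤q⇒0≤q-p (h′ n p))
  (Q.solve 3 (λ x y e → ((Q.:- x) Q.:+ e) Q.:- (Q.:- y) Q.:= (y Q.:+ e) Q.:- x)
    refl (seq x n) (seq y n) ε)

+-cong : ∀ {x y u v} → x ≃ y → u ≃ v → x + u ≃ y + v
+-cong {x} {y} {u} {v} h k = ≤-antisym {x + u} {y + v}
  (+-mono-≤ {x} {y} {u} {v} (≃⇒≤ {x} {y} h) (≃⇒≤ {u} {v} k))
  (+-mono-≤ {y} {x} {v} {u} (≃⇒≥ {x} {y} h) (≃⇒≥ {u} {v} k))

neg-cong : ∀ {x y} → x ≃ y → - x ≃ - y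
neg-cong {x} {y} h = ≤-antisym { - x} { - y}
  (neg-mono-≤ {y} {x} (≃⇒≥ {x} {y} h)) (neg-mono-≤ {x} {y} (≃⇒≤ {x} {y} h))

bounded : ∀ x → ∃₂ λ N B → 0ℚ ℚ.< B × (∀ n → N ℕ.≤ n → ∣ seq x n ∣ ℚ.≤ B)
bounded x with cauchy x 1ℚ (ℚ.positive⁻¹ 1ℚ)
... | N , h = N , 1ℚ ℚ.+ ∣ seq x N ∣ ,
  ℚ.<-≤-trans (ℚ.positive⁻¹ 1ℚ) (subst (ℚ._≤ 1ℚ ℚ.+ ∣ seq x N ∣) (ℚ.+-identityʳ 1ℚ)
    (ℚ.+-monoʳ-≤ 1ℚ (ℚ.0≤∣p∣ (seq x N)))) ,
  λ n p → subst (λ z → ∣ z ∣ ℚ.≤ 1ℚ ℚ.+ ∣ seq x N ∣)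
    (Q.solve 2 (λ a b → (a Q.:- b) Q.:+ b Q.:= a) refl (seq x n) (seq x N))
    (ℚ.≤-trans (ℚ.∣p+q∣≤∣p∣+∣q∣ (seq x n ℚ.- seq x N) (seq x N))
      (ℚ.+-monoˡ-≤ ∣ seq x N ∣ (h n N p ℕ.≤-refl)))

*-congˡ : ∀ {x y} z → x ≃ y → x * z ≃ y * z
*-congˡ {x} {y} z h ε 0<ε =
  let M , B , 0<B , b = bounded z
      δ , 0<δ , δB≡ε = divide 0<ε 0<B
      N , h′ = h δ 0<δ
  in M ⊔ N , λ n p → begin
    ∣ seq x n ℚ.* seq z n ℚ.- seq y n ℚ.* seq z n ∣
      ≡⟨ cong ∣_∣ (Q.solve 3 (λ x y z → x Q.:* z Q.:- y Q.:* z Q.:= (x Q.:- y) Q.:* z) refl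
           (seq x n) (seq y n) (seq z n)) ⟩
    ∣ (seq x n ℚ.- seq y n) ℚ.* seq z n ∣
      ≡⟨ ℚ.∣p*q∣≡∣p∣*∣q∣ (seq x n ℚ.- seq y n) (seq z n) ⟩
    ∣ seq x n ℚ.- seq y n ∣ ℚ.* ∣ seq z n ∣
      ≤⟨ ℚ.*-monoʳ-≤-nonNeg ∣ seq z n ∣ {{ℚ.∣-∣-nonNeg (seq z n)}} (h′ n (ℕ.m⊔n≤o⇒n≤o M N p)) ⟩
    δ ℚ.* ∣ seq z n ∣
      ≤⟨ ℚ.*-monoˡ-≤-nonNeg δ {{ℚ.nonNegative (ℚ.<⇒≤ 0<δ)}} (b n (ℕ.m⊔n≤o⇒m≤o M N p)) ⟩
    δ ℚ.* B ≡⟨ δB≡ε ⟩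
    ε ∎
  where open ℚ.≤-Reasoning

*-comm : ∀ x y → x * y ≃ y * x
*-comm x y = ≃-pointwise {x * y} {y * x} λ n → ℚ.*-comm (seq x n) (seq y n)

*-cong : ∀ {x y u v} → x ≃ y → u ≃ v → x * u ≃ y * v
*-cong {x} {y} {u} {v} h k = ≃-trans {x * u} {y * u} {y * v} (*-congˡ {x} {y} u h)
  (≃-trans {y * u} {u * y} {y * v} (*-comm y u)
    (≃-trans {u * y} {v * y} {y * v} (*-congˡ {u} {v} y k) (*-comm v y)))

0≤* : ∀ {x y} → 0ℝ ≤ x → 0ℝ ≤ y → 0ℝ ≤ x * y
0≤* {x} {y} h k ε 0<ε =
  let M , A , 0<A , a = bounded x
      N , B , 0<B , b = bounded y
      δ , 0<δ , δ[A+B]≡ε = divide 0<ε (ℚ.+-mono-< 0<A 0<B)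
      M′ , h′ = h δ 0<δ
      N′ , k′ = k δ 0<δ
  in (M ⊔ N) ⊔ (M′ ⊔ N′) , λ n p →
    let p₁ = ℕ.m⊔n≤o⇒m≤o (M ⊔ N) (M′ ⊔ N′) p
        p₂ = ℕ.m⊔n≤o⇒n≤o (M ⊔ N) (M′ ⊔ N′) p
    in 0≤*-approx (seq x n) (seq y n) A B δ ε 0<ε 0<δ 0<A 0<B δ[A+B]≡ε
        (h′ n (ℕ.m⊔n≤o⇒m≤o M′ N′ p₂)) (k′ n (ℕ.m⊔n≤o⇒n≤o M′ N′ p₂))
        (ℚ.≤-trans (p≤∣p∣ (seq x n)) (a n (ℕ.m⊔n≤o⇒m≤o M N p₁)))
        (ℚ.≤-trans (p≤∣p∣ (seq y n)) (b n (ℕ.m⊔n≤o⇒n≤o M N p₁)))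

-- Unlike _≃_ and _≤_, these records are compared by their arguments, not by unfolding.
record _≈_ (x y : ℝ) : Set where
  constructor wrap
  field unwrap : x ≃ y

record _≼_ (x y : ℝ) : Set where
  constructor wrap
  field unwrap : x ≤ y

≈-refl : ∀ {x} → x ≈ x
≈-refl {x} = wrap (≃-refl {x})

≈-pointwise : ∀ {x y} → (∀ n → seq x n ≡ seq y n) → x ≈ y
≈-pointwise {x} {y} h = wrap (≃-pointwise {x} {y} h)

≈-isEquivalence : IsEquivalence _≈_
≈-isEquivalence = record
  { refl  = λ {x} → wrap (≃-refl {x})
  ; sym   = λ { {x} {y} (wrap h) → wrap (≃-sym {x} {y} h) }
  ; trans = λ { {x} {y} {z} (wrap h) (wrap k) → wrap (≃-trans {x} {y} {z} h k) }
  }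

ℝ-commutativeRing : CommutativeRing 0ℓ 0ℓ
ℝ-commutativeRing = record
  { Carrier = ℝ ; _≈_ = _≈_ ; _+_ = _+_ ; _*_ = _*_ ; -_ = -_ ; 0# = 0ℝ ; 1# = 1ℝ
  ; isCommutativeRing = record
    { isRing = record
      { +-isAbelianGroup = record
        { isGroup = record
          { isMonoid = record
            { isSemigroup = record
              { isMagma = record
                { isEquivalence = ≈-isEquivalence
                ; ∙-cong = λ { {x} {y} {u} {v} (wrap h) (wrap k) → wrap (+-cong {x} {y} {u} {v} h k) } }
              ; assoc = λ x y z → ≈-pointwise {(x + y) + z} {x + (y + z)}
                  λ n → ℚ.+-assoc (seq x n) (seq y n) (seq z n) }
            ; identity = (λ x → ≈-pointwise {0ℝ + x} {x} λ n → ℚ.+-identityˡ (seq x n))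
                       , (λ x → ≈-pointwise {x + 0ℝ} {x} λ n → ℚ.+-identityʳ (seq x n)) }
          ; inverse = (λ x → ≈-pointwise { - x + x} {0ℝ} λ n → ℚ.+-inverseˡ (seq x n))
                    , (λ x → ≈-pointwise {x + - x} {0ℝ} λ n → ℚ.+-inverseʳ (seq x n))
          ; ⁻¹-cong = λ { {x} {y} (wrap h) → wrap (neg-cong {x} {y} h) } }
        ; comm = λ x y → ≈-pointwise {x + y} {y + x} λ n → ℚ.+-comm (seq x n) (seq y n) }
      ; *-cong = λ { {x} {y} {u} {v} (wrap h) (wrap k) → wrap (*-cong {x} {y} {u} {v} h k) }
      ; *-assoc = λ x y z → ≈-pointwise {(x * y) * z} {x * (y * z)}
          λ n → ℚ.*-assoc (seq x n) (seq y n) (seq z n)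
      ; *-identity = (λ x → ≈-pointwise {1ℝ * x} {x} λ n → ℚ.*-identityˡ (seq x n))
                   , (λ x → ≈-pointwise {x * 1ℝ} {x} λ n → ℚ.*-identityʳ (seq x n))
      ; distrib = (λ x y z → ≈-pointwise {x * (y + z)} {x * y + x * z}
                      λ n → ℚ.*-distribˡ-+ (seq x n) (seq y n) (seq z n))
                , (λ x y z → ≈-pointwise {(y + z) * x} {y * x + z * x}
                      λ n → ℚ.*-distribʳ-+ (seq x n) (seq y n) (seq z n)) }
    ; *-comm = λ x y → wrap (*-comm x y) } }

<⇒≤ : ∀ {x y} → x < y → x ≤ y
<⇒≤ {x} {y} (δ , 0<δ , N , h) ε 0<ε = N , λ n p → ≤-byℚ _
  (0≤+ℚ (p≤q⇒0≤q-p (h n p)) (ℚ.<⇒≤ (ℚ.+-mono-< 0<δ 0<ε)))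
  (Q.solve 4 (λ x y d e → (y Q.:+ e) Q.:- x Q.:= (y Q.:- (x Q.:+ d)) Q.:+ (d Q.:+ e))
    refl (seq x n) (seq y n) δ ε)

-- The gap δ contradicts the opposite inequality taken with tolerance δ/2.
<⇒≱ : ∀ {x y} → x < y → ¬ (y ≤ x)
<⇒≱ {x} {y} (δ , 0<δ , M , h) y≤x =
  let N , k = y≤x _ (0<½*ℚ 0<δ)
      n = M ⊔ N
  in ℚ.<-irrefl refl (ℚ.<-≤-trans (0<½*ℚ 0<δ) (≤-byℚ _
    (0≤+ℚ (p≤q⇒0≤q-p (h n (ℕ.m≤m⊔n M N))) (p≤q⇒0≤q-p (k n (ℕ.m≤n⊔m M N))))
    (Q.solve 3 (λ x y d → Q.con 0ℚ Q.:- Q.con ½ Q.:* d Q.:=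
      (y Q.:- (x Q.:+ d)) Q.:+ (x Q.:+ Q.con ½ Q.:* d Q.:- y)) refl (seq x n) (seq y n) δ)))

-- Comparing the approximations at an index where both sequences have settled to
-- within ε/8 decides between x ≤ y + ε and y < x.
approximately-total : ∀ x y ε → 0ℚ ℚ.< ε →
  (∃ λ N → ∀ n → N ℕ.≤ n → seq x n ℚ.≤ seq y n ℚ.+ ε) ⊎ y < x
approximately-total x y ε 0<ε = compare (seq x N ℚ.≤? seq y N ℚ.+ ½ ℚ.* ε)
  where
  h = ½ ℚ.* (½ ℚ.* (½ ℚ.* ε))
  0<h : 0ℚ ℚ.< h
  0<h = 0<½*ℚ (0<½*ℚ (0<½*ℚ 0<ε))
  Nx = proj₁ (cauchy x h 0<h)
  Ny = proj₁ (cauchy y h 0<h)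
  N = Nx ⊔ Ny
  close-x : ∀ {j k} → N ℕ.≤ j → N ℕ.≤ k → 0ℚ ℚ.≤ h ℚ.- (seq x j ℚ.- seq x k)
  close-x {j} {k} p q = p≤q⇒0≤q-p (ℚ.≤-trans (p≤∣p∣ _) (proj₂ (cauchy x h 0<h) j k
    (ℕ.m⊔n≤o⇒m≤o Nx Ny p) (ℕ.m⊔n≤o⇒m≤o Nx Ny q)))
  close-y : ∀ {j k} → N ℕ.≤ j → N ℕ.≤ k → 0ℚ ℚ.≤ h ℚ.- (seq y j ℚ.- seq y k)
  close-y {j} {k} p q = p≤q⇒0≤q-p (ℚ.≤-trans (p≤∣p∣ _) (proj₂ (cauchy y h 0<h) j k
    (ℕ.m⊔n≤o⇒n≤o Nx Ny p) (ℕ.m⊔n≤o⇒n≤o Nx Ny q)))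
  compare : Dec (seq x N ℚ.≤ seq y N ℚ.+ ½ ℚ.* ε) →
    (∃ λ N → ∀ n → N ℕ.≤ n → seq x n ℚ.≤ seq y n ℚ.+ ε) ⊎ y < x
  compare (yes x≤) = inj₁ (N , λ n p → ≤-byℚ _
    (0≤+ℚ (0≤+ℚ (p≤q⇒0≤q-p x≤) (ℚ.<⇒≤ (0<½*ℚ (0<½*ℚ 0<ε))))
          (0≤+ℚ (close-x p ℕ.≤-refl) (close-y ℕ.≤-refl p)))
    (Q.solve 5 (λ x x′ y y′ e → (y Q.:+ e) Q.:- x Q.:=
        ((y′ Q.:+ Q.con ½ Q.:* e Q.:- x′) Q.:+ Q.con ½ Q.:* (Q.con ½ Q.:* e))
        Q.:+ ((Q.con ½ Q.:* (Q.con ½ Q.:* (Q.con ½ Q.:* e)) Q.:- (x Q.:- x′))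
          Q.:+ (Q.con ½ Q.:* (Q.con ½ Q.:* (Q.con ½ Q.:* e)) Q.:- (y′ Q.:- y))))
      refl (seq x n) (seq x N) (seq y n) (seq y N) ε))
  compare (no x≰) = inj₂ (½ ℚ.* (½ ℚ.* ε) , 0<½*ℚ (0<½*ℚ 0<ε) , N , λ n p → ≤-byℚ _
    (0≤+ℚ (p≤q⇒0≤q-p (ℚ.<⇒≤ (ℚ.≰⇒> x≰)))
          (0≤+ℚ (close-x ℕ.≤-refl p) (close-y p ℕ.≤-refl)))
    (Q.solve 5 (λ x x′ y y′ e → x Q.:- (y Q.:+ Q.con ½ Q.:* (Q.con ½ Q.:* e)) Q.:=
        (x′ Q.:- (y′ Q.:+ Q.con ½ Q.:* e))
        Q.:+ ((Q.con ½ Q.:* (Q.con ½ Q.:* (Q.con ½ Q.:* e)) Q.:- (x′ Q.:- x))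
          Q.:+ (Q.con ½ Q.:* (Q.con ½ Q.:* (Q.con ½ Q.:* e)) Q.:- (y Q.:- y′))))
      refl (seq x n) (seq x N) (seq y n) (seq y N) ε))

-- For each ε the comparison yields either the required bound or `y < x`, which is excluded. The
-- stability of `_≤_` rests on this.
≮⇒≥ : ∀ {x y} → ¬ (y < x) → x ≤ y
≮⇒≥ {x} {y} y≮x ε 0<ε with approximately-total x y ε 0<ε
... | inj₁ h   = h
... | inj₂ y<x = ⊥-elim (y≮x y<x)

-- The product of the gaps is a gap for the product: xy - ab = (x - a)(y - b) + a(y - b) + b(x - a).
0<x*y : ∀ {x y} → 0ℝ < x → 0ℝ < y → 0ℝ < x * y
0<x*y {x} {y} (a , 0<a , M , h) (b , 0<b , N , k) = a ℚ.* b , 0<*ℚ 0<a 0<b , M ⊔ N , λ n p →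
  let 0≤x-a = p≤q⇒0≤q-p (h n (ℕ.m⊔n≤o⇒m≤o M N p))
      0≤y-b = p≤q⇒0≤q-p (k n (ℕ.m⊔n≤o⇒n≤o M N p))
  in ≤-byℚ _ (0≤+ℚ (0≤*ℚ 0≤x-a 0≤y-b) (0≤+ℚ (0≤*ℚ (ℚ.<⇒≤ 0<a) 0≤y-b) (0≤*ℚ (ℚ.<⇒≤ 0<b) 0≤x-a)))
    (Q.solve 4 (λ x y a b → x Q.:* y Q.:- (Q.con 0ℚ Q.:+ a Q.:* b) Q.:=
        (x Q.:- (Q.con 0ℚ Q.:+ a)) Q.:* (y Q.:- (Q.con 0ℚ Q.:+ b))
        Q.:+ (a Q.:* (y Q.:- (Q.con 0ℚ Q.:+ b)) Q.:+ b Q.:* (x Q.:- (Q.con 0ℚ Q.:+ a))))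
      refl (seq x n) (seq y n) a b)

fromℚ-positive : ∀ {q} → 0ℚ ℚ.< q → 0ℝ < fromℚ q
fromℚ-positive {q} 0<q = q , 0<q , 0 , λ _ _ → ℚ.≤-reflexive (ℚ.+-identityˡ q)

<-≤-trans : ∀ {x y z} → x < y → y ≤ z → x < z
<-≤-trans {x} {y} {z} (δ , 0<δ , M , h) y≤z =
  let N , k = y≤z _ (0<½*ℚ 0<δ)
  in ½ ℚ.* δ , 0<½*ℚ 0<δ , M ⊔ N , λ n p → ≤-byℚ _
    (0≤+ℚ (p≤q⇒0≤q-p (h n (ℕ.m⊔n≤o⇒m≤o M N p))) (p≤q⇒0≤q-p (k n (ℕ.m⊔n≤o⇒n≤o M N p))))
    (Q.solve 4 (λ x y z d → z Q.:- (x Q.:+ Q.con ½ Q.:* d) Q.:=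
      (y Q.:- (x Q.:+ d)) Q.:+ (z Q.:+ Q.con ½ Q.:* d Q.:- y)) refl (seq x n) (seq y n) (seq z n) δ)

-- Through this map the ring solver over ℝ takes rational coefficients. The laws hold by computation
-- on constant sequences.
fromℚ-morphism : CommutativeRing.rawRing ℚ.+-*-commutativeRing
                 ACR.-Raw-AlmostCommutative⟶ ACR.fromCommutativeRing ℝ-commutativeRing
fromℚ-morphism = record
  { ⟦_⟧    = fromℚ
  ; +-homo = λ p q → ≈-pointwise {fromℚ (p ℚ.+ q)} {fromℚ p + fromℚ q} λ _ → refl
  ; *-homo = λ p q → ≈-pointwise {fromℚ (p ℚ.* q)} {fromℚ p * fromℚ q} λ _ → refl
  ; -‿homo = λ p → ≈-pointwise {fromℚ (ℚ.- p)} { - fromℚ p} λ _ → refl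
  ; 0-homo = ≈-refl {0ℝ}
  ; 1-homo = ≈-refl {1ℝ}
  }

ℝ-ordered : StableOrderedRing
ℝ-ordered = record
  { commutativeRing = ℝ-commutativeRing
  ; _≤_ = _≼_
  ; ≈⇒≤ = λ { {x} {y} (wrap h) → wrap (≃⇒≤ {x} {y} h) }
  ; ≤-trans = λ { {x} {y} {z} (wrap h) (wrap k) → wrap (≤-trans {x} {y} {z} h k) }
  ; ≤-antisym = λ { {x} {y} (wrap h) (wrap k) → wrap (≤-antisym {x} {y} h k) }
  ; ≤-stable = λ {x} {y} h → wrap (≮⇒≥ {x} {y} λ y<x → h λ { (wrap x≤y) → <⇒≱ {y} {x} y<x x≤y })
  ; ≰⇒≥ = λ {x} {y} x≰y → wrap (≮⇒≥ {y} {x} λ x<y → x≰y (wrap (<⇒≤ {x} {y} x<y)))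
  ; +-mono-≤ = λ { {x} {y} {u} {v} (wrap h) (wrap k) → wrap (+-mono-≤ {x} {y} {u} {v} h k) }
  ; 0≤* = λ { {x} {y} (wrap h) (wrap k) → wrap (0≤* {x} {y} h k) }
  -- `x≰0` does not yield `0ℝ < x` outright, but since the goal is a contradiction, each strict
  -- inequality may be assumed in turn through `≮⇒≥`.
  ; 0<* = λ { {x} {y} x≰0 y≰0 (wrap xy≤0) → x≰0 (wrap (≮⇒≥ {x} {0ℝ} λ 0<x →
      y≰0 (wrap (≮⇒≥ {y} {0ℝ} λ 0<y → <⇒≱ {0ℝ} {x * y} (0<x*y {x} {y} 0<x 0<y) xy≤0)))) }
  ; ι = fromℚ-morphism
  ; fromℚ-nonNeg = λ {q} 0≤q → wrap (≤-pointwise {0ℝ} {fromℚ q} λ _ → 0≤q)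
  ; fromℚ-pos = λ { {q} 0<q (wrap q≤0) → <⇒≱ {0ℝ} {fromℚ q} (fromℚ-positive 0<q) q≤0 }
  }

-- The eigenvalue bounds

0<1/100÷k : ∀ {k} → 1 ℕ.≤ k → 0ℝ < fromℚ 1/100 ÷ k
0<1/100÷k {suc k} _ = 0<x*y {fromℚ (+ 1 ℚ./ suc k)} {fromℚ 1/100}
  (fromℚ-positive (0<1/n k)) (fromℚ-positive (ℚ.positive⁻¹ 1/100))

≈-reflexive : ∀ {x y} → x ≡ y → x ≈ y
≈-reflexive refl = ≈-refl

∑-def : ∀ {A : Set} xs (f : A → ℝ) → ∑ xs f ≡ List.foldr (λ a r → f a + r) (fromℚ 0ℚ) xs
∑-def xs f = refl

module _ {n} (G : Graph n) where
  Γ-def : ∀ f g x → Γ G f g x ≡ (Δ G (λ y → f y * g y) x - g x * Δ G f x - f x * Δ G g x) ÷ 2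
  Γ-def f g x = refl

  Γ₂-def : ∀ f g x → Γ₂ G f g x ≡ (Δ G (Γ G f g) x - Γ G g (Δ G f) x - Γ G f (Δ G g) x) ÷ 2
  Γ₂-def f g x = refl

ℝ-bounds : ∀ {m} (G : Graph (suc (suc m))) → _
ℝ-bounds G = TwoVertices.bounds ℝ-ordered G ∑ _+_ _*_ _-_ -_ _÷_ fromℚ (Δ G) (Γ G) (Γ₂ G)
  (λ xs f → ≈-reflexive (∑-def xs f))
  (λ x y → ≈-refl {x + y}) (λ x y → ≈-refl {x * y}) (λ x → ≈-refl { - x}) (λ q → ≈-refl {fromℚ q})
  (λ x y → ≈-refl {x - y}) (λ x → ≈-refl {0ℝ}) (λ x k → ≈-refl {x ÷ suc k})
  (λ f x → ≈-refl {Δ G f x}) (λ f g x → ≈-reflexive (Γ-def G f g x)) (λ f g x → ≈-reflexive (Γ₂-def G f g x))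

unwrap-bounds : ∀ {a b c e : ℝ} {K : Set} → a ≈ 0ℝ × K × c ≼ b × e ≼ fromℚ 2ℚ - c →
  a ≃ 0ℝ × K × c ≤ b × e ≤ 2ℝ - c
unwrap-bounds (wrap h , k , wrap h′ , wrap h″) = h , k , h′ , h″

spectral-bounds : ∀ {m} (G : Graph (suc (suc m))) →
  Connected G → TriangleFree G → ¬ Bipartite G → CD0∞ G →
  ∀ (D : ℕ) → IsDiameter G D → ∀ (ev : Fin (suc (suc m)) → ℝ) → IsSpectrum G ev →
  ev zero ≃ 0ℝ × 1 ℕ.≤ maxDegree G ℕ.* D ^ 2 ×
  fromℚ 1/100 ÷ (maxDegree G ℕ.* D ^ 2) ≤ ev (suc zero) ×
  ev (opposite zero) ≤ 2ℝ - fromℚ 1/100 ÷ (maxDegree G ℕ.* D ^ 2)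
spectral-bounds G connected triangle-free ¬bipartite cd D diam ev
  (ev-mono , φ , eigen , independent , spanning) =
  unwrap-bounds
  {ev zero} {ev (suc zero)} {fromℚ 1/100 ÷ (maxDegree G ℕ.* D ^ 2)} {ev (opposite zero)}
  (ℝ-bounds G triangle-free ¬bipartite (λ g x → wrap (cd g x)) D (1≤diameter G connected diam)
    (λ x y → let k , (walk , _) , k≤D = proj₁ diam x y in k , walk , k≤D) (neighbour G connected)
    ev (λ i j i≤j → wrap (ev-mono i j i≤j)) φ
    (λ i → (λ φ≈0 → proj₁ (eigen i) (λ x → _≈_.unwrap (φ≈0 x))) , λ x → wrap (proj₂ (eigen i) x))
    (λ a a·φ≈0 i → wrap (independent a (λ x → _≈_.unwrap (a·φ≈0 x)) i))
    (λ f → let a , f≃a·φ = spanning f in a , λ x → wrap (f≃a·φ x)))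

theorem1p3 : ∃₂ λ (c C : ℝ) → 0ℝ < c × 0ℝ < C ×
    (∀ (n : ℕ) (G : Graph n) →
      Connected G → TriangleFree G → ¬ Bipartite G → CD0∞ G →
      ∀ (D : ℕ) → IsDiameter G D →
      ∀ (ev : Fin n → ℝ) → IsSpectrum G ev →
      Σ (2 ℕ.≤ n) λ 2≤n →
        let d  = maxDegree G
            λ₁ = ev (inject≤ zero 2≤n)
            λ₂ = ev (inject≤ (suc zero) 2≤n)
            λₙ = ev (opposite (inject≤ zero 2≤n))
        in  λ₁ ≃ 0ℝ
          × 0ℝ < λ₂
          × c ÷ (d ℕ.* D ^ 2) ≤ λ₂
          × (∀ i j → inject≤ (suc zero) 2≤n Fin.≤ i → i Fin.≤ j → ev i ≤ ev j)
          × λₙ ≤ 2ℝ - C ÷ (d ℕ.* D ^ 2))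
theorem1p3 = fromℚ 1/100 , fromℚ 1/100 , 0<1/100 , 0<1/100 , λ where
    zero          G _ _ ¬bipartite → ⊥-elim (ℕ.n≮0 (2≤n G ¬bipartite))
    (suc zero)    G _ _ ¬bipartite → ⊥-elim (ℕ.n≮n 1 (2≤n G ¬bipartite))
    (suc (suc m)) G connected triangle-free ¬bipartite cd D diam ev spectrum →
      let first≃0 , 1≤dD² , θ≤second , last≤2-θ =
            spectral-bounds G connected triangle-free ¬bipartite cd D diam ev spectrum
      -- On `suc (suc m)` vertices the `inject≤` indices compute to `zero` and `suc zero`, so the
      -- bounds apply directly.
      in s≤s (s≤s z≤n) , first≃0 ,
         <-≤-trans {0ℝ} {fromℚ 1/100 ÷ (maxDegree G ℕ.* D ^ 2)} {ev (suc zero)} (0<1/100÷k 1≤dD²) θ≤second ,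
         θ≤second , (λ i j _ i≤j → proj₁ spectrum i j i≤j) , last≤2-θ
  where
  0<1/100 : 0ℝ < fromℚ 1/100
  0<1/100 = fromℚ-positive (ℚ.positive⁻¹ 1/100)
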